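{- Let $G$ be a simple connected undirected graph of order $n\ge 2$ that is $r$-regular and $k$-resistance regular. Then the double graph $D_2G$ satisfies $$E_R(D_2G)=\rho_1(G)+\frac{2n}{r},$$ where $\rho_1(G)$ is the largest eigenvalue of the resistance distance matrix of $G$.
   Context: For a connected graph $G$ with vertices $v_1,\dots,v_n$, Laplacian matrix $L$ (degree matrix minus adjacency matrix) and Moore-Penrose inverse $L^\dagger=(l^\dagger_{ij})$, the resistance distance is $r_{ij}=l^\dagger_{ii}+l^\dagger_{jj}-2l^\dagger_{ij}$, and the resistance distance matrix is $R(G)=(r_{ij})$. $G$ is $k$-resistance regular if every row sum of $R(G)$ equals $k$; it is $r$-regular if every vertex has degree $r$. The resistance energy $E_R(G)$ is the sum of the absolute values of the eigenvalues of $R(G)$, counted with multiplicity. The double graph $D_2G$ of a graph $G$ with vertices $v_1,\dots,v_n$ is obtained by taking $G$ together with another copy of $G$ on vertices $v_1',\dots,v_n'$ ($v_i'$ corresponding to $v_i$) and joining, for each $i$, $v_i'$ to every vertex in the neighborhood $N(v_i)$ of $v_i$ in $G$. -}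

module Defs where

open import Level using (_⊔_) renaming (suc to lsuc)
open import Algebra.Bundles using (CommutativeRing; Semiring)
open import Algebra.Core using (Op₁; Op₂)
open import Algebra.Apartness.Structures using (IsHeytingField)
import Algebra.Definitions.RawSemiring as RawSemiringDefs
import Algebra.Properties.Ring as RingProperties
open import Data.Bool.Base using (Bool; true; false; if_then_else_; T)
open import Data.Fin.Base using (Fin; zero; suc; toℕ; splitAt)
open import Data.Fin.Properties using (_≟_)
open import Data.Fin.Subset using (Subset; ∣_∣)
open import Data.Nat.Base as ℕ using (ℕ; zero; suc)
open import Data.Product.Base using (∃-syntax; Σ-syntax; _×_; _,_; proj₁)
open import Data.Sum.Base using (_⊎_; inj₁; inj₂)
import Data.Vec.Base as Vec
open import Data.Vec.Functional using (Vector; removeAt)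
open import Relation.Binary.Core using (Rel)
open import Relation.Binary.Construct.Closure.ReflexiveTransitive using (Star)
open import Relation.Binary.Lattice.Definitions using (Supremum)
open import Relation.Binary.PropositionalEquality.Core using (_≡_; refl)
open import Relation.Binary.Structures using (IsStrictPartialOrder)
open import Relation.Nullary.Decidable.Core using (does)
open import Relation.Nullary.Negation.Core using (¬_; contradiction)

-- The reals, given by their axioms: a Cauchy complete Archimedean
-- ordered field.  These axioms determine ℝ up to isomorphism.  They are
-- phrased constructively (the order is not assumed decidable, and
-- maxima are part of the structure), so that the Cauchy reals are a
-- model without appeal to excluded middle.

record RealField c ℓ₁ ℓ₂ : Set (lsuc (c ⊔ ℓ₁ ⊔ ℓ₂)) where
  infix  8 -_
  infixl 7 _*_
  infixl 6 _+_ _∨_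
  infix  4 _≈_ _<_ _≤_ _#_
  field
    Carrier : Set c
    _≈_     : Rel Carrier ℓ₁
    _<_     : Rel Carrier ℓ₂
    _+_     : Op₂ Carrier
    _*_     : Op₂ Carrier
    _∨_     : Op₂ Carrier
    -_      : Op₁ Carrier
    0#      : Carrier
    1#      : Carrier

  _#_ : Rel Carrier ℓ₂
  x # y = x < y ⊎ y < x

  _≤_ : Rel Carrier ℓ₂
  x ≤ y = ¬ (y < x)

  field
    isHeytingField       : IsHeytingField _≈_ _#_ _+_ _*_ -_ 0# 1#
    isStrictPartialOrder : IsStrictPartialOrder _≈_ _<_
    +-monoˡ-<            : ∀ z {x y} → x < y → x + z < y + z
    *-pos                : ∀ {x y} → 0# < x → 0# < y → 0# < x * y
    ∨-supremum           : Supremum _≤_ _∨_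

  open IsHeytingField isHeytingField public
    using (isCommutativeRing; #⇒invertible; invertible⇒#; tight)

  commutativeRing : CommutativeRing c ℓ₁
  commutativeRing = record { isCommutativeRing = isCommutativeRing }

  open CommutativeRing commutativeRing public
    using (_-_; semiring)

  open RawSemiringDefs (Semiring.rawSemiring semiring) public
    using (sum; product; _^_) renaming (_×_ to _·_)

  fromℕ : ℕ → Carrier
  fromℕ n = n · 1#

  abs : Carrier → Carrier
  abs x = x ∨ - x

  IsCauchy : (ℕ → Carrier) → Set (c ⊔ ℓ₂)
  IsCauchy s = ∀ ε → 0# < ε →
    ∃[ N ] ∀ m n → N ℕ.≤ m → N ℕ.≤ n → abs (s m - s n) < ε

  ConvergesTo : (ℕ → Carrier) → Carrier → Set (c ⊔ ℓ₂)
  ConvergesTo s l = ∀ ε → 0# < ε →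
    ∃[ N ] ∀ n → N ℕ.≤ n → abs (s n - l) < ε

  field
    archimedean : ∀ x → ∃[ n ] x < fromℕ n
    complete    : ∀ s → IsCauchy s → ∃[ l ] ConvergesTo s l

record Graph (n : ℕ) : Set where
  field
    adj        : Fin n → Fin n → Bool
    adj-sym    : ∀ i j → adj i j ≡ adj j i
    adj-irrefl : ∀ i → adj i i ≡ false

  Adjacent : Rel (Fin n) _
  Adjacent i j = T (adj i j)

  neighbourhood : Fin n → Subset n
  neighbourhood i = Vec.tabulate (adj i)

  degree : Fin n → ℕ
  degree i = ∣ neighbourhood i ∣

open Graph

-- Graphs on no vertices also satisfy this; the order is bounded below
-- separately.
Connected : ∀ {n} → Graph n → Set
Connected G = ∀ i j → Star (Adjacent G) i j

Regular : ∀ {n} → Graph n → ℕ → Set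
Regular G r = ∀ i → degree G i ≡ r

-- Under  splitAt n : Fin (n + n) → Fin n ⊎ Fin n  the vertex vᵢ is inj₁ i
-- and its copy vᵢ′ is inj₂ i.
double : ∀ {n} → Graph n → Graph (n ℕ.+ n)
double {n} G = record
  { adj        = λ u v → adj₂ (splitAt n u) (splitAt n v)
  ; adj-sym    = λ u v → adj₂-sym (splitAt n u) (splitAt n v)
  ; adj-irrefl = λ u → adj₂-irrefl (splitAt n u)
  }
  where
  adj₂ : Fin n ⊎ Fin n → Fin n ⊎ Fin n → Bool
  adj₂ (inj₁ i) (inj₁ j) = adj G i j
  adj₂ (inj₂ i) (inj₂ j) = adj G i j
  adj₂ (inj₂ i) (inj₁ j) = adj G i j
  adj₂ (inj₁ i) (inj₂ j) = adj G j i

  adj₂-sym : ∀ x y → adj₂ x y ≡ adj₂ y x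
  adj₂-sym (inj₁ i) (inj₁ j) = adj-sym G i j
  adj₂-sym (inj₂ i) (inj₂ j) = adj-sym G i j
  adj₂-sym (inj₂ i) (inj₁ j) = refl
  adj₂-sym (inj₁ i) (inj₂ j) = refl

  adj₂-irrefl : ∀ x → adj₂ x x ≡ false
  adj₂-irrefl (inj₁ i) = adj-irrefl G i
  adj₂-irrefl (inj₂ i) = adj-irrefl G i

module Resistance {c ℓ₁ ℓ₂} (ℝ : RealField c ℓ₁ ℓ₂) where

  open RealField ℝ public

  private
    module R = CommutativeRing commutativeRing
    module < = IsStrictPartialOrder isStrictPartialOrder
    open RingProperties R.ring using (-‿distribˡ-*; -‿involutive)

    0<1 : 0# < 1#
    0<1 with invertible⇒# {1#} {0#} (1# , 1*[1-0]≈1 , R.trans (R.*-comm _ _) 1*[1-0]≈1)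
      where
      -0≈0 : - 0# R.≈ 0#
      -0≈0 = R.trans (R.sym (R.+-identityˡ _)) (R.-‿inverseʳ 0#)

      1*[1-0]≈1 : 1# * (1# - 0#) R.≈ 1#
      1*[1-0]≈1 =
        R.trans (R.*-identityˡ _) (R.trans (R.+-congˡ -0≈0) (R.+-identityʳ _))
    ... | inj₂ 0<1 = 0<1
    ... | inj₁ 1<0 = contradiction (<.trans 0<1′ 1<0) (<.irrefl R.refl)
      where
      0<-1 : 0# < - 1#
      0<-1 = <.<-respˡ-≈ (R.-‿inverseʳ 1#)
               (<.<-respʳ-≈ (R.+-identityˡ _) (+-monoˡ-< (- 1#) 1<0))

      -1*-1≈1 : - 1# * - 1# R.≈ 1#
      -1*-1≈1 = R.trans (R.sym (-‿distribˡ-* 1# (- 1#)))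
                  (R.trans (R.-‿cong (R.*-identityˡ _)) (-‿involutive 1#))

      0<1′ : 0# < 1#
      0<1′ = <.<-respʳ-≈ -1*-1≈1 (*-pos 0<-1 0<-1)

  0<fromℕ : ∀ m → 0# < fromℕ (suc m)
  0<fromℕ zero    = <.<-respʳ-≈ (R.sym (R.+-identityʳ 1#)) 0<1
  0<fromℕ (suc m) = <.trans (0<fromℕ m)
    (<.<-respˡ-≈ (R.+-identityˡ _) (+-monoˡ-< (fromℕ (suc m)) 0<1))

  infixl 7 _/ℕ_

  -- Total, with the convention x / 0 = 0.  The inverse supplied is that of
  -- the difference  fromℕ (suc m) - 0#.
  _/ℕ_ : Carrier → ℕ → Carrier
  x /ℕ zero  = 0#
  x /ℕ suc m = x * proj₁ (#⇒invertible {fromℕ (suc m)} {0#} (inj₂ (0<fromℕ m)))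

  Matrix : ℕ → ℕ → Set c
  Matrix m n = Vector (Vector Carrier n) m

  infix 4 _≋_
  _≋_ : ∀ {m n} → Matrix m n → Matrix m n → Set ℓ₁
  A ≋ B = ∀ i j → A i j ≈ B i j

  infixl 7 _⊗_
  _⊗_ : ∀ {l m n} → Matrix l m → Matrix m n → Matrix l n
  (A ⊗ B) i j = sum λ k → A i k * B k j

  infixl 8 _ᵀ
  _ᵀ : ∀ {m n} → Matrix m n → Matrix n m
  (A ᵀ) i j = A j i

  identity : ∀ {n} → Matrix n n
  identity i j = if does (i ≟ j) then 1# else 0#

  -- Laplace expansion along the first row.
  det : ∀ {n} → Matrix n n → Carrier
  det {zero}  A = 1#
  det {suc n} A = sum λ j →
    (- 1#) ^ toℕ j * A zero j * det λ i → removeAt (A (suc i)) j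

  charPoly : ∀ {n} → Matrix n n → Carrier → Carrier
  charPoly A x = det λ i j → x * identity i j - A i j

  IsEigenvalue : ∀ {n} → Matrix n n → Carrier → Set (c ⊔ ℓ₁)
  IsEigenvalue {n} A μ = Σ[ v ∈ Vector Carrier n ]
    ¬ (∀ i → v i ≈ 0#) × (∀ i → sum (λ j → A i j * v j) ≈ μ * v i)

  IsLargestEigenvalue : ∀ {n} → Matrix n n → Carrier → Set (c ⊔ ℓ₁ ⊔ ℓ₂)
  IsLargestEigenvalue A ρ = IsEigenvalue A ρ × (∀ μ → IsEigenvalue A μ → μ ≤ ρ)

  -- λs lists the roots of the characteristic polynomial with their
  -- multiplicities.  Equality of polynomials is tested on all arguments,
  -- which is the same thing as ℝ is infinite.
  HasSpectrum : ∀ {n} → Matrix n n → Vector Carrier n → Set (c ⊔ ℓ₁)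
  HasSpectrum A λs = ∀ x → charPoly A x ≈ product (λ i → x - λs i)

  record IsMoorePenroseInverse {m n} (A : Matrix m n) (A† : Matrix n m) : Set ℓ₁ where
    field
      AA†A≋A      : A ⊗ A† ⊗ A ≋ A
      A†AA†≋A†    : A† ⊗ A ⊗ A† ≋ A†
      AA†-selfAdj : (A ⊗ A†) ᵀ ≋ A ⊗ A†
      A†A-selfAdj : (A† ⊗ A) ᵀ ≋ A† ⊗ A

  -- The Moore-Penrose inverse (unique) and the list of eigenvalues (unique
  -- up to order) enter as relations, not as functions.

  adjacencyMatrix degreeMatrix laplacian : ∀ {n} → Graph n → Matrix n n
  adjacencyMatrix G i j = if adj G i j then 1# else 0#
  degreeMatrix    G i j = fromℕ (degree G i) * identity i j
  laplacian       G i j = degreeMatrix G i j - adjacencyMatrix G i j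

  IsResistanceMatrix : ∀ {n} → Graph n → Matrix n n → Set (c ⊔ ℓ₁)
  IsResistanceMatrix {n} G R = Σ[ L† ∈ Matrix n n ]
    IsMoorePenroseInverse (laplacian G) L† ×
    (∀ i j → R i j ≈ L† i i + L† j j - fromℕ 2 * L† i j)

  ResistanceRegular : ∀ {n} → Graph n → Carrier → Set (c ⊔ ℓ₁)
  ResistanceRegular G k = ∃[ R ] IsResistanceMatrix G R × (∀ i → sum (R i) ≈ k)

  IsLargestResistanceEigenvalue : ∀ {n} → Graph n → Carrier → Set (c ⊔ ℓ₁ ⊔ ℓ₂)
  IsLargestResistanceEigenvalue G ρ =
    ∃[ R ] IsResistanceMatrix G R × IsLargestEigenvalue R ρ

  IsResistanceEnergy : ∀ {n} → Graph n → Carrier → Set (c ⊔ ℓ₁)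
  IsResistanceEnergy G E = ∃[ R ] IsResistanceMatrix G R ×
    (∃[ λs ] HasSpectrum R λs × E ≈ sum (λ i → abs (λs i)))

module Submission where

-- Let X be the Moore-Penrose inverse of the Laplacian of a graph on N vertices.
-- It is symmetric, positive semidefinite, and its rows sum to zero.  Hence the
-- i-th row sum of the resistance matrix R is N Xᵢᵢ + tr X, and if these row sums
-- all equal k, then the diagonal of X is a constant d, so that R = 2dJ - 2X with
-- J the all-ones matrix, and k = 2Nd.  On vectors orthogonal to the all-ones
-- vector R acts as -2X, which is negative semidefinite; therefore k is the
-- largest eigenvalue (largestEigenvalue≈rowSum).
--
-- For a graph of this kind the energy is 2k (energy): one root of the
-- characteristic polynomial is k, the others are at most 0, and the sum of all
-- roots is the trace of R, which is 0.  Since the eigenvalues are given as roots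
-- with multiplicities, this is derived from determinants.  Column operations give
-- det (xI - R) = (x - k) q(x)  and  det (xI + 2X) = x q(x)  for one polynomial q.
-- The matrix xI + 2X is positive definite for x > 0, so q has no positive zero
-- (boundedBelow⇒det≉0), and after removal of the factor x - k no positive root is
-- left.  The sum of the roots is compared with the trace through the first two
-- coefficients of det (I - yR) (sum-spectrum≈trace).
--
-- The matrices of the double graph are direct sums: on the vectors (v, v) its
-- Laplacian is 2L, on the vectors (v, -v) it is 2r I (laplacian-double).  So its
-- Moore-Penrose inverse is the direct sum of X/2 and I/(2r), with the constant
-- diagonal (d/2 + 1/(2r))/2, as Moore-Penrose inverses are unique (MP-unique).
-- The row sums of its resistance matrix are therefore k/2 + n/r, where n is the
-- order of the original graph, and its energy is twice that, k + 2n/r.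
--
-- The order of the reals is not decidable, but the conclusion is an equation and
-- equality is stable under double negation, so classical case distinctions may
-- be made in its proof.

open import Data.Nat.Base using (ℕ) renaming (_≤_ to _≤ℕ_; _*_ to _*ℕ_)
open import Defs
open import Algebra.Apartness.Structures using (IsHeytingField)
open import Algebra.Bundles using (CommutativeRing)
import Algebra.Properties.AbelianGroup as AbelianGroupProperties
import Algebra.Properties.CommutativeMonoid.Sum as CommutativeMonoidSum
import Algebra.Properties.Ring as RingProperties
import Algebra.Properties.Semiring.Mult as SemiringMult
import Algebra.Properties.Semiring.Sum as SemiringSum
import Algebra.Solver.Ring as RingSolver
open import Algebra.Solver.Ring.AlmostCommutativeRing using (fromCommutativeRing; _-Raw-AlmostCommutative⟶_)
open import Data.Bool.Base using (Bool; true; false; if_then_else_; T)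
open import Data.Fin.Base using (Fin; zero; suc; toℕ; punchIn; splitAt)
open import Data.Fin.Subset using (∣_∣)
open import Data.Integer.Base as ℤ using (ℤ; +_; -[1+_]; _⊖_)
import Data.Integer.Properties as ℤ
open import Data.Maybe.Base using (Maybe; just; nothing)
open import Data.Nat.Base as ℕ using (zero; suc; z≤n; s≤s)
open import Data.Product.Base using (∃-syntax; _×_; _,_; proj₁; proj₂)
open import Data.Sum.Base as Sum using (_⊎_; inj₁; inj₂)
import Data.Vec.Base as Vec
open import Data.Vec.Functional using (Vector; removeAt; updateAt; _∷_)
open import Function.Base using (const)
open import Level using (_⊔_)
open import Relation.Binary.Construct.Closure.ReflexiveTransitive using (_◅_)
open import Relation.Binary.PropositionalEquality.Core as ≡ using (_≡_)
import Relation.Binary.Reasoning.Setoid as SetoidReasoning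
open import Relation.Binary.Structures using (IsStrictPartialOrder)
open import Relation.Nullary using (yes; no)
open import Relation.Nullary.Negation.Core using (¬_; contradiction)

-- Ring solver with integer coefficients
--
-- Equality of coefficients taken from the ring itself need not be decidable, so
-- with those, terms such as x - x would not cancel.  The solver therefore
-- normalises with coefficients in ℤ, interpreted through the canonical
-- homomorphism.
module ℤCoefficients {c ℓ} (R : CommutativeRing c ℓ) where

  open CommutativeRing R
  open RingProperties ring using (-‿distribˡ-*; -‿distribʳ-*; -‿involutive; -0#≈0#)
  open AbelianGroupProperties +-abelianGroup using (⁻¹-∙-comm)
  open SemiringMult semiring using (×-homo-+; ×1-homo-*; ×-homo-1) renaming (_×_ to _·_)
  open SetoidReasoning setoid

  -- The clause for 1 makes the literal 1 denote 1# itself; from 2 on, literals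
  -- denote multiples of 1# in the form used by  fromℕ.
  ⟦_⟧ₙ : ℕ → Carrier
  ⟦ 0            ⟧ₙ = 0#
  ⟦ 1            ⟧ₙ = 1#
  ⟦ suc (suc n)  ⟧ₙ = suc (suc n) · 1#

  ⟦_⟧ : ℤ → Carrier
  ⟦ + n      ⟧ = ⟦ n ⟧ₙ
  ⟦ -[1+ n ] ⟧ = - ⟦ suc n ⟧ₙ

  ⟦+_⟧ : ∀ n → ⟦ + n ⟧ ≈ n · 1#
  ⟦+ 0 ⟧           = refl
  ⟦+ 1 ⟧           = sym (×-homo-1 1#)
  ⟦+ suc (suc n) ⟧ = refl

  ⟦-_⟧ : ∀ n → ⟦ ℤ.- (+ n) ⟧ ≈ - (n · 1#)
  ⟦- zero ⟧  = sym -0#≈0#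
  ⟦- suc n ⟧ = -‿cong ⟦+ suc n ⟧

  -‿homo : ∀ i → ⟦ ℤ.- i ⟧ ≈ - ⟦ i ⟧
  -‿homo (+ zero)  = sym -0#≈0#
  -‿homo (+ suc n) = refl
  -‿homo -[1+ n ]  = sym (-‿involutive _)

  ⊖-homo : ∀ m n → ⟦ m ⊖ n ⟧ ≈ m · 1# + - (n · 1#)
  ⊖-homo m zero = begin
    ⟦ + m ⟧         ≈⟨ ⟦+ m ⟧ ⟩
    m · 1#          ≈⟨ +-identityʳ _ ⟨
    m · 1# + 0#     ≈⟨ +-congˡ -0#≈0# ⟨
    m · 1# + - 0#   ∎
  ⊖-homo zero (suc n) = trans (⟦- suc n ⟧) (sym (+-identityˡ _))
  ⊖-homo (suc m) (suc n) = begin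
    ⟦ suc m ⊖ suc n ⟧                     ≡⟨ ≡.cong ⟦_⟧ (ℤ.[1+m]⊖[1+n]≡m⊖n m n) ⟩
    ⟦ m ⊖ n ⟧                             ≈⟨ ⊖-homo m n ⟩
    a + - b                               ≈⟨ +-congʳ (+-identityʳ a) ⟨
    a + 0# + - b                          ≈⟨ +-congʳ (+-congˡ (-‿inverseʳ 1#)) ⟨
    a + (1# + - 1#) + - b                 ≈⟨ +-congʳ (+-assoc _ _ _) ⟨
    a + 1# + - 1# + - b                   ≈⟨ +-assoc _ _ _ ⟩
    a + 1# + (- 1# + - b)                 ≈⟨ +-cong (+-comm _ _) (⁻¹-∙-comm 1# b) ⟩
    1# + a + - (1# + b)                   ∎
    where
    a = m · 1#
    b = n · 1#

  +-homo : ∀ i j → ⟦ i ℤ.+ j ⟧ ≈ ⟦ i ⟧ + ⟦ j ⟧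
  +-homo (+ m) (+ n) = begin
    ⟦ + (m ℕ.+ n) ⟧     ≈⟨ ⟦+ m ℕ.+ n ⟧ ⟩
    (m ℕ.+ n) · 1#      ≈⟨ ×-homo-+ 1# m n ⟩
    m · 1# + n · 1#     ≈⟨ +-cong ⟦+ m ⟧ ⟦+ n ⟧ ⟨
    ⟦ + m ⟧ + ⟦ + n ⟧   ∎
  +-homo (+ m) -[1+ n ] = trans (⊖-homo m (suc n)) (+-cong (sym ⟦+ m ⟧) (-‿cong (sym ⟦+ suc n ⟧)))
  +-homo -[1+ m ] (+ n) = trans (⊖-homo n (suc m))
      (trans (+-comm _ _) (+-cong (-‿cong (sym ⟦+ suc m ⟧)) (sym ⟦+ n ⟧)))
  +-homo -[1+ m ] -[1+ n ] = begin
    - ⟦ + (2 ℕ.+ (m ℕ.+ n)) ⟧              ≡⟨ ≡.cong (λ k → - ⟦ + k ⟧) (eq m n) ⟩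
    - ⟦ + (suc m ℕ.+ suc n) ⟧              ≈⟨ -‿cong (+-homo (+ suc m) (+ suc n)) ⟩
    - (⟦ + suc m ⟧ + ⟦ + suc n ⟧)          ≈⟨ ⁻¹-∙-comm _ _ ⟨
    - ⟦ + suc m ⟧ + - ⟦ + suc n ⟧          ∎
    where
    eq : ∀ m n → 2 ℕ.+ (m ℕ.+ n) ≡ suc m ℕ.+ suc n
    eq zero    n = ≡.refl
    eq (suc m) n = ≡.cong suc (eq m n)

  +*+-homo : ∀ m n → ⟦ + (m ℕ.* n) ⟧ ≈ ⟦ + m ⟧ * ⟦ + n ⟧
  +*+-homo m n = begin
    ⟦ + (m ℕ.* n) ⟧     ≈⟨ ⟦+ m ℕ.* n ⟧ ⟩
    (m ℕ.* n) · 1#      ≈⟨ ×1-homo-* m n ⟩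
    m · 1# * (n · 1#)   ≈⟨ *-cong ⟦+ m ⟧ ⟦+ n ⟧ ⟨
    ⟦ + m ⟧ * ⟦ + n ⟧   ∎

  *-homoˡ : ∀ m j → ⟦ + m ℤ.* j ⟧ ≈ ⟦ + m ⟧ * ⟦ j ⟧
  *-homoˡ m (+ n) = trans (reflexive (≡.cong ⟦_⟧ (≡.sym (ℤ.pos-* m n)))) (+*+-homo m n)
  *-homoˡ m -[1+ n ] = begin
    ⟦ + m ℤ.* -[1+ n ] ⟧          ≡⟨ ≡.cong ⟦_⟧ (ℤ.neg-distribʳ-* (+ m) (+ suc n)) ⟨
    ⟦ ℤ.- (+ m ℤ.* + suc n) ⟧     ≈⟨ -‿homo (+ m ℤ.* + suc n) ⟩
    - ⟦ + m ℤ.* + suc n ⟧         ≈⟨ -‿cong (*-homoˡ m (+ suc n)) ⟩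
    - (⟦ + m ⟧ * ⟦ + suc n ⟧)     ≈⟨ -‿distribʳ-* _ _ ⟩
    ⟦ + m ⟧ * - ⟦ + suc n ⟧       ∎

  *-homo : ∀ i j → ⟦ i ℤ.* j ⟧ ≈ ⟦ i ⟧ * ⟦ j ⟧
  *-homo (+ m)    j = *-homoˡ m j
  *-homo -[1+ m ] j = begin
    ⟦ -[1+ m ] ℤ.* j ⟧            ≡⟨ ≡.cong ⟦_⟧ (ℤ.neg-distribˡ-* (+ suc m) j) ⟨
    ⟦ ℤ.- (+ suc m ℤ.* j) ⟧       ≈⟨ -‿homo (+ suc m ℤ.* j) ⟩
    - ⟦ + suc m ℤ.* j ⟧           ≈⟨ -‿cong (*-homoˡ (suc m) j) ⟩
    - (⟦ + suc m ⟧ * ⟦ j ⟧)       ≈⟨ -‿distribˡ-* _ _ ⟩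
    - ⟦ + suc m ⟧ * ⟦ j ⟧         ∎

  morphism : ℤ.+-*-rawRing -Raw-AlmostCommutative⟶ fromCommutativeRing R
  morphism = record
    { ⟦_⟧    = ⟦_⟧
    ; +-homo = +-homo
    ; *-homo = *-homo
    ; -‿homo = -‿homo
    ; 0-homo = refl
    ; 1-homo = refl
    }

  _coeff≟_ : ∀ i j → Maybe (⟦ i ⟧ ≈ ⟦ j ⟧)
  i coeff≟ j with i ℤ.≟ j
  ... | yes i≡j = just (reflexive (≡.cong ⟦_⟧ i≡j))
  ... | no  _   = nothing

  open RingSolver ℤ.+-*-rawRing (fromCommutativeRing R) morphism _coeff≟_ public
    using (solve; _:=_; _:+_; _:*_; _:-_; :-_; con)

-- Ring operations, finite sums and equational reasoning over the reals
module RealAlgebra {c ℓ₁ ℓ₂} (ℝ : RealField c ℓ₁ ℓ₂) where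

  open Resistance ℝ public
  open CommutativeRing commutativeRing public
    using ( setoid; refl; sym; trans; reflexive; *-commutativeMonoid
          ; +-cong; +-congˡ; +-congʳ; *-cong; *-congˡ; *-congʳ; -‿cong
          ; +-assoc; +-comm; +-identityˡ; +-identityʳ; -‿inverseʳ
          ; *-assoc; *-comm; *-identityˡ; *-identityʳ; zeroˡ; zeroʳ; distribˡ )
  open ℤCoefficients commutativeRing public using (solve; _:=_; _:+_; _:*_; _:-_; :-_; con)
  open SemiringSum semiring public
    using (sum-cong-≋; sum-replicate; sum-replicate-zero; sum-remove; ∑-distrib-+; ∑-comm; *-distribˡ-sum; *-distribʳ-sum)
  open SemiringMult semiring public using (×-homo-+; ×1-homo-*)
  open SetoidReasoning setoid public

-- Order, inverses and absolute values
module Order {c ℓ₁ ℓ₂} (ℝ : RealField c ℓ₁ ℓ₂) where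

  open RealAlgebra ℝ
  private
    module < = IsStrictPartialOrder isStrictPartialOrder
    module H = IsHeytingField isHeytingField

  private variable
    x y z w : Carrier

  -- Equality is the negation of apartness.  Hence an equation may be proved
  -- by classical reasoning.
  ≈-stable : ¬ ¬ (x ≈ y) → x ≈ y
  ≈-stable {x} {y} ¬¬x≈y = proj₁ (tight x y) λ x#y → ¬¬x≈y λ x≈y → proj₂ (tight x y) x≈y x#y

  <-cotrans : x < y → ∀ z → x < z ⊎ z < y
  <-cotrans x<y z with H.#-cotrans (inj₁ x<y) z
  ... | inj₁ (inj₁ x<z) = inj₁ x<z
  ... | inj₁ (inj₂ z<x) = inj₂ (<.trans z<x x<y)
  ... | inj₂ (inj₁ z<y) = inj₂ z<y
  ... | inj₂ (inj₂ y<z) = inj₁ (<.trans x<y y<z)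

  <⇒≤ : x < y → x ≤ y
  <⇒≤ x<y y<x = <.irrefl refl (<.trans x<y y<x)

  <⇒≉ : x < y → ¬ (x ≈ y)
  <⇒≉ x<y x≈y = <.irrefl x≈y x<y

  ≤-reflexive : x ≈ y → x ≤ y
  ≤-reflexive x≈y y<x = <.irrefl (sym x≈y) y<x

  ≤-trans : x ≤ y → y ≤ z → x ≤ z
  ≤-trans {y = y} x≤y y≤z z<x with <-cotrans z<x y
  ... | inj₁ z<y = y≤z z<y
  ... | inj₂ y<x = x≤y y<x

  <-≤-trans : x < y → y ≤ z → x < z
  <-≤-trans {z = z} x<y y≤z with <-cotrans x<y z
  ... | inj₁ x<z = x<z
  ... | inj₂ z<y = contradiction z<y y≤z

  ≤-<-trans : x ≤ y → y < z → x < z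
  ≤-<-trans {x = x} x≤y y<z with <-cotrans y<z x
  ... | inj₁ y<x = contradiction y<x x≤y
  ... | inj₂ x<z = x<z

  ≤-antisym : x ≤ y → y ≤ x → x ≈ y
  ≤-antisym {x} {y} x≤y y≤x = proj₁ (tight x y) λ { (inj₁ x<y) → y≤x x<y ; (inj₂ y<x) → x≤y y<x }

  ≤-resp : x ≈ y → z ≈ w → x ≤ z → y ≤ w
  ≤-resp x≈y z≈w x≤z w<y = x≤z (<.<-respʳ-≈ (sym x≈y) (<.<-respˡ-≈ (sym z≈w) w<y))

  <-resp : x ≈ y → z ≈ w → x < z → y < w
  <-resp x≈y z≈w x<z = <.<-respˡ-≈ x≈y (<.<-respʳ-≈ z≈w x<z)

  +-monoˡ-≤ : ∀ z → x ≤ y → x + z ≤ y + z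
  +-monoˡ-≤ {x} {y} z x≤y y+z<x+z = x≤y (<-resp (cancel y) (cancel x) (+-monoˡ-< (- z) y+z<x+z))
    where
    cancel : ∀ a → a + z + - z ≈ a
    cancel a = solve 2 (λ a z → a :+ z :+ (:- z) := a) refl a z

  +-mono-≤ : x ≤ y → z ≤ w → x + z ≤ y + w
  +-mono-≤ {x} {y} {z} {w} x≤y z≤w =
    ≤-trans (+-monoˡ-≤ z x≤y) (≤-resp (+-comm z y) (+-comm w y) (+-monoˡ-≤ y z≤w))

  0≤y-x⇒x≤y : 0# ≤ y - x → x ≤ y
  0≤y-x⇒x≤y {y} {x} 0≤y-x =
    ≤-resp (+-identityˡ x) (solve 2 (λ x y → y :- x :+ x := y) refl x y) (+-monoˡ-≤ x 0≤y-x)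

  x≤y⇒0≤y-x : x ≤ y → 0# ≤ y - x
  x≤y⇒0≤y-x {x} x≤y = ≤-resp (-‿inverseʳ x) refl (+-monoˡ-≤ (- x) x≤y)

  0<y-x⇒x<y : 0# < y - x → x < y
  0<y-x⇒x<y {y} {x} 0<y-x =
    <-resp (+-identityˡ x) (solve 2 (λ x y → y :- x :+ x := y) refl x y) (+-monoˡ-< x 0<y-x)

  x<y⇒0<y-x : x < y → 0# < y - x
  x<y⇒0<y-x {x} x<y = <-resp (-‿inverseʳ x) refl (+-monoˡ-< (- x) x<y)

  0≤+ : 0# ≤ x → 0# ≤ y → 0# ≤ x + y
  0≤+ 0≤x 0≤y = ≤-resp (+-identityˡ 0#) refl (+-mono-≤ 0≤x 0≤y)

  neg-pos : x < 0# → 0# < - x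
  neg-pos {x} x<0 = <-resp refl (+-identityˡ (- x)) (x<y⇒0<y-x x<0)

  neg-nonneg : x ≤ 0# → 0# ≤ - x
  neg-nonneg {x} x≤0 = ≤-resp refl (+-identityˡ (- x)) (x≤y⇒0≤y-x x≤0)

  pos-neg : 0# < - x → x < 0#
  pos-neg {x} 0<-x = 0<y-x⇒x<y (<-resp refl (sym (+-identityˡ (- x))) 0<-x)

  -- A classical case distinction, available under a double negation.
  0≤-cases : 0# ≤ x → ¬ ¬ (0# ≈ x ⊎ 0# < x)
  0≤-cases 0≤x k = k (inj₁ (≤-antisym 0≤x λ 0<x → k (inj₂ 0<x)))

  0≤* : 0# ≤ x → 0# ≤ y → 0# ≤ x * y
  0≤* {x} {y} 0≤x 0≤y xy<0 = 0≤-cases 0≤x λ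
    { (inj₁ 0≈x) → <.irrefl (trans (*-congʳ (sym 0≈x)) (zeroˡ y)) xy<0
    ; (inj₂ 0<x) → 0≤-cases 0≤y λ
      { (inj₁ 0≈y) → <.irrefl (trans (*-congˡ (sym 0≈y)) (zeroʳ x)) xy<0
      ; (inj₂ 0<y) → <⇒≤ (*-pos 0<x 0<y) xy<0 } }

  0<1# : 0# < 1#
  0<1# = <-resp refl (+-identityʳ 1#) (0<fromℕ 0)

  #⇒0<sq : x # 0# → 0# < x * x
  #⇒0<sq (inj₂ 0<x) = *-pos 0<x 0<x
  #⇒0<sq {x} (inj₁ x<0) = <-resp refl (solve 1 (λ x → (:- x) :* (:- x) := x :* x) refl x)
      (*-pos (neg-pos x<0) (neg-pos x<0))

  0≤sq : ∀ x → 0# ≤ x * x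
  0≤sq x x*x<0 = <.irrefl (trans (*-congʳ x≈0) (zeroˡ x)) x*x<0
    where
    x≈0 : x ≈ 0#
    x≈0 = proj₁ (tight x 0#) λ x#0 → <⇒≤ (#⇒0<sq x#0) x*x<0

  sq≈0⇒≈0 : x * x ≈ 0# → x ≈ 0#
  sq≈0⇒≈0 {x} x*x≈0 = proj₁ (tight x 0#) λ x#0 → <⇒≉ (#⇒0<sq x#0) (sym x*x≈0)

  0≤x+x⇒0≤x : ∀ {x} → 0# ≤ x + x → 0# ≤ x
  0≤x+x⇒0≤x {x} 0≤x+x x<0 = 0≤x+x (pos-neg (<-resp
      refl (solve 1 (λ x → (:- x) :+ (:- x) := :- (x :+ x)) refl x) 0<-x-x))
    where
    0<-x-x : 0# < - x + - x
    0<-x-x = <-≤-trans (neg-pos x<0) (0≤y-x⇒x≤y (≤-resp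
        refl (solve 1 (λ y → y := y :+ y :- y) refl (- x)) (<⇒≤ (neg-pos x<0))))

  inverse : x # 0# → ∃[ y ] x * y ≈ 1#
  inverse {x} x#0 with #⇒invertible x#0
  ... | y , _ , [x-0]*y≈1 = y , trans (*-congʳ (solve 1 (λ x → x := x :- con (ℤ.+ 0)) refl x)) [x-0]*y≈1

  *-cancelˡ-0 : x # 0# → x * y ≈ 0# → y ≈ 0#
  *-cancelˡ-0 {x} {y} x#0 x*y≈0 with inverse x#0
  ... | x⁻¹ , x*x⁻¹≈1 = begin
    y              ≈⟨ *-identityˡ y ⟨
    1# * y         ≈⟨ *-congʳ x*x⁻¹≈1 ⟨
    x * x⁻¹ * y    ≈⟨ solve 3 (λ x i y → x :* i :* y := i :* (x :* y)) refl x x⁻¹ y ⟩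
    x⁻¹ * (x * y)  ≈⟨ *-congˡ x*y≈0 ⟩
    x⁻¹ * 0#       ≈⟨ zeroʳ x⁻¹ ⟩
    0#             ∎

  *-cancelˡ : x # 0# → x * y ≈ x * z → y ≈ z
  *-cancelˡ {x} {y} {z} x#0 xy≈xz = begin
    y            ≈⟨ solve 2 (λ y z → y := (y :- z) :+ z) refl y z ⟩
    y - z + z
      ≈⟨ +-congʳ (*-cancelˡ-0 x#0 (trans (solve 3 (λ x y z → x :* (y :- z) := x :* y :- x :* z) refl x y z)
          (trans (+-congʳ xy≈xz) (-‿inverseʳ _)))) ⟩
    0# + z       ≈⟨ +-identityˡ z ⟩
    z            ∎

  *-≉0 : ¬ (x ≈ 0#) → ¬ (y ≈ 0#) → ¬ (x * y ≈ 0#)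
  *-≉0 x≉0 y≉0 xy≈0 = x≉0 (proj₁ (tight _ 0#) λ x#0 → y≉0 (*-cancelˡ-0 x#0 xy≈0))

  inverse-pos : 0# < x → x * y ≈ 1# → 0# < y
  inverse-pos {x} {y} 0<x xy≈1 with <-cotrans 0<1# (x * y)
  ... | inj₂ xy<1 = contradiction xy≈1 (<⇒≉ xy<1)
  ... | inj₁ 0<xy with invertible⇒# {y} {0#} (x , (trans (*-congˡ y-0≈y) xy≈1) , trans (*-congʳ y-0≈y)
      (trans (*-comm y x) xy≈1))
    where
    y-0≈y : y - 0# ≈ y
    y-0≈y = solve 1 (λ x → x :- con (ℤ.+ 0) := x) refl y
  ... | inj₂ 0<y = 0<y
  ... | inj₁ y<0 = contradiction 0<xy (<⇒≤ (pos-neg (<-resp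
      refl (solve 2 (λ x y → x :* (:- y) := :- (x :* y)) refl x y) (*-pos 0<x (neg-pos y<0)))))

  fromℕ#0 : ∀ {n} → Fin n → fromℕ n # 0#
  fromℕ#0 {suc n} _ = inj₂ (0<fromℕ n)

  /ℕ-inverse : ∀ x {m} → 0 ℕ.< m → fromℕ m * (x /ℕ m) ≈ x
  /ℕ-inverse x {suc m} _ with #⇒invertible {fromℕ (suc m)} {0#} (inj₂ (0<fromℕ m))
  ... | i , _ , [m-0]*i≈1 = begin
    fromℕ (suc m) * (x * i)
      ≈⟨ solve 3 (λ m x i → m :* (x :* i) := x :* ((m :- con (ℤ.+ 0)) :* i)) refl (fromℕ (suc m)) x i ⟩
    x * ((fromℕ (suc m) - 0#) * i)   ≈⟨ *-congˡ [m-0]*i≈1 ⟩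
    x * 1#                           ≈⟨ *-identityʳ x ⟩
    x                                ∎

  abs-nonneg : 0# ≤ x → abs x ≈ x
  abs-nonneg {x} 0≤x with ∨-supremum x (- x)
  ... | x≤abs , _ , least = ≤-antisym (least x (≤-reflexive refl) -x≤x) x≤abs
    where
    -x≤x : - x ≤ x
    -x≤x = 0≤y-x⇒x≤y (≤-resp refl (solve 1 (λ x → x :+ x := x :- (:- x)) refl x) (0≤+ 0≤x 0≤x))

  abs-nonpos : x ≤ 0# → abs x ≈ - x
  abs-nonpos {x} x≤0 with ∨-supremum x (- x)
  ... | _ , -x≤abs , least = ≤-antisym (least (- x) x≤-x (≤-reflexive refl)) -x≤abs
    where
    0≤-x = neg-nonneg x≤0
    x≤-x : x ≤ - x
    x≤-x = 0≤y-x⇒x≤y (≤-resp refl (solve 1 (λ x → (:- x) :+ (:- x) := (:- x) :- x) refl x) (0≤+ 0≤-x 0≤-x))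

  sum-nonneg : ∀ {n} (f : Vector Carrier n) → (∀ i → 0# ≤ f i) → 0# ≤ sum f
  sum-nonneg {zero}  f 0≤f = ≤-reflexive refl
  sum-nonneg {suc n} f 0≤f = 0≤+ (0≤f zero) (sum-nonneg (λ i → f (suc i)) λ i → 0≤f (suc i))

  sum-nonneg-≈0 : ∀ {n} (f : Vector Carrier n) → (∀ i → 0# ≤ f i) → sum f ≤ 0# → ∀ i → f i ≈ 0#
  sum-nonneg-≈0 {suc n} f 0≤f Σf≤0 = λ
    { zero    → ≤-antisym (≤-trans (f₀≤Σf) Σf≤0) (0≤f zero)
    ; (suc i) → sum-nonneg-≈0 (λ i → f (suc i)) (λ i → 0≤f (suc i)) (≤-trans Σf′≤Σf Σf≤0) i }
    where
    Σf′ = sum λ i → f (suc i)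
    0≤Σf′ : 0# ≤ Σf′
    0≤Σf′ = sum-nonneg (λ i → f (suc i)) (λ i → 0≤f (suc i))
    f₀≤Σf : f zero ≤ sum f
    f₀≤Σf = 0≤y-x⇒x≤y (≤-resp refl (solve 2 (λ a b → b := a :+ b :- a) refl (f zero) Σf′) 0≤Σf′)
    Σf′≤Σf : Σf′ ≤ sum f
    Σf′≤Σf = 0≤y-x⇒x≤y (≤-resp refl (solve 2 (λ a b → a := a :+ b :- b) refl (f zero) Σf′) (0≤f zero))

-- Determinants
module Determinant {c ℓ₁ ℓ₂} (ℝ : RealField c ℓ₁ ℓ₂) where

  open RealAlgebra ℝ

  private variable
    m n : ℕ

  sum-linear : ∀ (a b : Carrier) {f g h : Vector Carrier n} →
               (∀ i → f i ≈ a * g i + b * h i) → sum f ≈ a * sum g + b * sum h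
  sum-linear a b {f} {g} {h} f≈ag+bh = begin
    sum f                                           ≈⟨ sum-cong-≋ f≈ag+bh ⟩
    sum (λ i → a * g i + b * h i)                   ≈⟨ ∑-distrib-+ (λ i → a * g i) (λ i → b * h i) ⟩
    sum (λ i → a * g i) + sum (λ i → b * h i)       ≈⟨ +-cong (*-distribˡ-sum a g) (*-distribˡ-sum b h) ⟨
    a * sum g + b * sum h                           ∎

  sum-zero : {f : Vector Carrier n} → (∀ i → f i ≈ 0#) → sum f ≈ 0#
  sum-zero {n} f≈0 = trans (sum-cong-≋ f≈0) (sum-replicate-zero n)

  -- The sign of column j in the expansion of a determinant along the first row.
  sgn : Fin n → Carrier
  sgn j = (- 1#) ^ toℕ j

  sgn*sgn : (j : Fin n) → sgn j * sgn j ≈ 1#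
  sgn*sgn zero    = *-identityˡ 1#
  sgn*sgn (suc j) = trans (solve 1 (λ s → con -[1+ 0 ] :* s :* (con -[1+ 0 ] :* s) := s :* s) refl (sgn j))
      (sgn*sgn j)

  -- The matrix A without its first row and its column j.
  minor : Matrix (suc m) (suc n) → Fin (suc n) → Matrix m n
  minor A j i = removeAt (A (suc i)) j

  -- The matrix with first column u and remaining columns B.
  infixr 5 _∣_
  _∣_ : Vector Carrier m → Matrix m n → Matrix m (suc n)
  (u ∣ B) i = u i ∷ B i

  ∣-cong : {u v : Vector Carrier m} {B C : Matrix m n} → (∀ i → u i ≈ v i) → B ≋ C → (u ∣ B) ≋ (v ∣ C)
  ∣-cong u≈v B≋C i zero    = u≈v i
  ∣-cong u≈v B≋C i (suc j) = B≋C i j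

  det-cong : {A B : Matrix n n} → A ≋ B → det A ≈ det B
  det-cong {zero}  A≋B = refl
  det-cong {suc n} A≋B = sum-cong-≋ {suc n} λ j →
    *-cong (*-congˡ {x = sgn j} (A≋B zero j)) (det-cong λ i k → A≋B (suc i) (punchIn j k))

  minor-∣ : (u : Vector Carrier (suc m)) (B : Matrix (suc m) (suc n)) (j : Fin (suc n)) →
            minor (u ∣ B) (suc j) ≋ ((λ i → u (suc i)) ∣ minor B j)
  minor-∣ u B j i zero    = refl
  minor-∣ u B j i (suc k) = refl

  -- Linearity in the first column.  In the expansion along the first row the
  -- first minor does not involve that column, and the others are linear in it
  -- by induction.
  det-linear : ∀ a b (u v : Vector Carrier (suc n)) (B : Matrix (suc n) n) →
               det ((λ i → a * u i + b * v i) ∣ B) ≈ a * det (u ∣ B) + b * det (v ∣ B)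
  det-linear {n} a b u v B = sum-linear a b (term n u v B)
    where
    term : ∀ n (u v : Vector Carrier (suc n)) (B : Matrix (suc n) n) j → let w = λ i → a * u i + b * v i in
      sgn j * (w ∣ B) zero j * det (minor (w ∣ B) j) ≈
      a * (sgn j * (u ∣ B) zero j * det (minor (u ∣ B) j))
          + b * (sgn j * (v ∣ B) zero j * det (minor (v ∣ B) j))
    term n u v B zero = solve 6 (λ s a b u v d → s :* (a :* u :+ b :* v) :* d :=
        a :* (s :* u :* d) :+ b :* (s :* v :* d)) refl
      (sgn {suc n} zero) a b (u zero) (v zero) (det (λ i → B (suc i)))
    term (suc n) u v B (suc j) = begin
      s * B zero j * det (minor (w ∣ B) (suc j))
        ≈⟨ *-congˡ (det-cong (minor-∣ w B j)) ⟩
      s * B zero j * det ((λ i → w (suc i)) ∣ minor B j)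
        ≈⟨ *-congˡ (det-linear a b (λ i → u (suc i)) (λ i → v (suc i)) (minor B j)) ⟩
      s * B zero j * (a * det ((λ i → u (suc i)) ∣ minor B j) + b * det ((λ i → v (suc i)) ∣ minor B j))
        ≈⟨ *-congˡ (+-cong (*-congˡ (det-cong (minor-∣ u B j))) (*-congˡ (det-cong (minor-∣ v B j)))) ⟨
      s * B zero j * (a * det (minor (u ∣ B) (suc j)) + b * det (minor (v ∣ B) (suc j)))
        ≈⟨ solve 6 (λ s e a b d f → s :* e :* (a :* d :+ b :* f) := a :* (s :* e :* d) :+ b :* (s :* e :* f))
            refl
             s (B zero j) a b (det (minor (u ∣ B) (suc j))) (det (minor (v ∣ B) (suc j))) ⟩
      a * (s * B zero j * det (minor (u ∣ B) (suc j))) + b * (s * B zero j * det (minor (v ∣ B) (suc j))) ∎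
      where
      w = λ i → a * u i + b * v i
      s = sgn (suc j)

  det-zeroColumn : (A : Matrix (suc n) (suc n)) → (∀ i → A i zero ≈ 0#) → det A ≈ 0#
  -- The zero column is the linear combination 0 u + 0 v of any two columns.
  det-zeroColumn {n} A A₀≈0 = begin
    det A
      ≈⟨ det-cong {A = A} {(λ i → 0# * 0# + 0# * 0#) ∣ B}
          (λ { i zero → trans (A₀≈0 i) 0≈ ; i (suc j) → refl }) ⟩
    det ((λ i → 0# * 0# + 0# * 0#) ∣ B)          ≈⟨ det-linear 0# 0# (λ _ → 0#) (λ _ → 0#) B ⟩
    0# * det (0s ∣ B) + 0# * det (0s ∣ B)
      ≈⟨ solve 1 (λ d → con (+ 0) :* d :+ con (+ 0) :* d := con (+ 0)) refl (det (0s ∣ B)) ⟩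
    0#                                           ∎
    where
    B = λ i j → A i (suc j)
    0s = λ i → 0#
    0≈ : 0# ≈ 0# * 0# + 0# * 0#
    0≈ = solve 0 (con (+ 0) := con (+ 0) :* con (+ 0) :+ con (+ 0) :* con (+ 0)) refl

  det-firstRow : (A : Matrix (suc n) (suc n)) → (∀ j → A zero (suc j) ≈ 0#) →
                 det A ≈ A zero zero * det (λ i j → A (suc i) (suc j))
  det-firstRow {n} A A₀≈0 = begin
    1# * a * d + sum rest     ≈⟨ +-congˡ (sum-zero rest≈0) ⟩
    1# * a * d + 0#           ≈⟨ solve 2 (λ a d → con (+ 1) :* a :* d :+ con (+ 0) := a :* d) refl a d ⟩
    a * d                     ∎
    where
    a = A zero zero
    d = det (λ i j → A (suc i) (suc j))
    rest : Vector Carrier n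
    rest j = sgn (suc j) * A zero (suc j) * det (minor A (suc j))
    rest≈0 : ∀ j → rest j ≈ 0#
    rest≈0 j = trans (*-congʳ (*-congˡ (A₀≈0 j))) (solve 2 (λ s d → s :* con (+ 0) :* d := con (+ 0))
        refl (sgn (suc j)) (det (minor A (suc j))))

  -- In the expansion along the first row the first two terms cancel; every
  -- other minor again has equal first and second columns.
  det-equalColumns₀₁ : (A : Matrix (suc (suc n)) (suc (suc n))) → (∀ i → A i zero ≈ A i (suc zero)) → det A ≈ 0#
  det-equalColumns₀₁ {n} A A₀≈A₁ = begin
    1# * a₀ * d₀ + (- 1# * 1# * a₁ * d₁ + sum rest)
      ≈⟨ +-cong (*-cong (*-congˡ (A₀≈A₁ zero)) (det-cong d₀≋d₁)) (+-congˡ (sum-zero (rest≈0 n A A₀≈A₁))) ⟩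
    1# * a₁ * d₁ + (- 1# * 1# * a₁ * d₁ + 0#)
      ≈⟨ solve 2 (λ a d → con (+ 1) :* a :* d :+ (con -[1+ 0 ] :* con (+ 1) :* a :* d :+ con (+ 0)) :=
          con (+ 0)) refl a₁ d₁ ⟩
    0# ∎
    where
    a₀ = A zero zero
    a₁ = A zero (suc zero)
    d₀ = det (minor A zero)
    d₁ = det (minor A (suc zero))
    rest : Vector Carrier n
    rest j = sgn (suc (suc j)) * A zero (suc (suc j)) * det (minor A (suc (suc j)))
    d₀≋d₁ : minor A zero ≋ minor A (suc zero)
    d₀≋d₁ i zero    = sym (A₀≈A₁ (suc i))
    d₀≋d₁ i (suc j) = refl
    rest≈0 : ∀ n (A : Matrix (suc (suc n)) (suc (suc n))) → (∀ i → A i zero ≈ A i (suc zero)) →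
             ∀ j → sgn (suc (suc j)) * A zero (suc (suc j)) * det (minor A (suc (suc j))) ≈ 0#
    rest≈0 (suc n) A A₀≈A₁ j =
      trans (*-congˡ (det-equalColumns₀₁ (minor A (suc (suc j))) λ i → A₀≈A₁ (suc i))) (zeroʳ _)

  -- The reordering of columns that puts column k first and keeps the order of
  -- the others.
  toFront : Fin (suc n) → Fin (suc n) → Fin (suc n)
  toFront k zero    = k
  toFront k (suc j) = punchIn k j

  -- The index of column k among the columns that are left when the j-th
  -- column other than k is deleted.
  position : Fin (suc n) → Fin n → Fin n
  position zero    zero    = zero
  position zero    (suc j) = zero
  position (suc k) zero    = k
  position (suc k) (suc j) = suc (position k j)

  punchIn-position : (k : Fin (suc n)) (j : Fin n) → punchIn (punchIn k j) (position k j) ≡ k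
  punchIn-position zero    zero    = ≡.refl
  punchIn-position zero    (suc j) = ≡.refl
  punchIn-position (suc k) zero    = ≡.refl
  punchIn-position (suc k) (suc j) = ≡.cong suc (punchIn-position k j)

  punchIn-punchIn : (k : Fin (suc (suc n))) (j : Fin (suc n)) (l : Fin n) →
                    punchIn (punchIn k j) (punchIn (position k j) l) ≡ punchIn k (punchIn j l)
  punchIn-punchIn zero    zero    l       = ≡.refl
  punchIn-punchIn zero    (suc j) l       = ≡.refl
  punchIn-punchIn (suc k) zero    l       = ≡.refl
  punchIn-punchIn (suc k) (suc j) zero    = ≡.refl
  punchIn-punchIn (suc k) (suc j) (suc l) = ≡.cong suc (punchIn-punchIn k j l)

  sgn-position : (k : Fin (suc n)) (j : Fin n) → sgn (suc j) * sgn (position k j) ≈ sgn k * sgn (punchIn k j)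
  sgn-position zero    zero    = *-comm _ _
  sgn-position zero    (suc j) = *-comm _ _
  sgn-position (suc k) zero    = solve 1 (λ s → con -[1+ 0 ] :* con (+ 1) :* s :=
      con -[1+ 0 ] :* s :* con (+ 1)) refl (sgn k)
  sgn-position (suc k) (suc j) = begin
    - 1# * sgn (suc j) * (- 1# * sgn (position k j))   ≈⟨ drop (sgn (suc j)) (sgn (position k j)) ⟩
    sgn (suc j) * sgn (position k j)                   ≈⟨ sgn-position k j ⟩
    sgn k * sgn (punchIn k j)                          ≈⟨ drop (sgn k) (sgn (punchIn k j)) ⟨
    - 1# * sgn k * (- 1# * sgn (punchIn k j))          ∎
    where
    drop : ∀ a b → - 1# * a * (- 1# * b) ≈ a * b
    drop a b = solve 2 (λ a b → con -[1+ 0 ] :* a :* (con -[1+ 0 ] :* b) := a :* b) refl a b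

  -- Moving column k to the front multiplies the determinant by the sign of k:
  -- in both expansions along the first row the minors correspond, and by
  -- induction they differ by the sign of the position of column k in them.
  det-toFront : (A : Matrix (suc n) (suc n)) (k : Fin (suc n)) → det (λ i j → A i (toFront k j)) ≈ sgn k * det A
  det-toFront {n} A k = begin
    1# * A zero k * D + sum (λ j → sgn (suc j) * A zero
        (punchIn k j) * det (λ i l → A (suc i) (toFront k (punchIn (suc j) l))))
      ≈⟨ +-cong first (trans (sum-cong-≋ (term n A k)) (sym (*-distribˡ-sum (sgn k) (removeAt t k)))) ⟩
    sgn k * t k + sgn k * sum (removeAt t k)     ≈⟨ distribˡ (sgn k) _ _ ⟨
    sgn k * (t k + sum (removeAt t k))           ≈⟨ *-congˡ (sum-remove {i = k} t) ⟨
    sgn k * det A                                ∎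
    where
    D = det (minor A k)
    t : Vector Carrier (suc n)
    t j = sgn j * A zero j * det (minor A j)
    first : 1# * A zero k * D ≈ sgn k * t k
    first = sym (trans (solve 3 (λ s a d → s :* (s :* a :* d) := s :* s :* a :* d) refl (sgn k) (A zero k) D)
                  (*-congʳ (*-congʳ (sgn*sgn k))))
    term : ∀ n (A : Matrix (suc n) (suc n)) k j →
      sgn (suc j) * A zero (punchIn k j) * det (λ i l → A (suc i) (toFront k (punchIn (suc j) l))) ≈
      sgn k * (sgn (punchIn k j) * A zero (punchIn k j) * det (minor A (punchIn k j)))
    term (suc n) A k j = begin
      sgn (suc j) * a * det (λ i l → A (suc i) (toFront k (punchIn (suc j) l)))
        ≈⟨ *-congˡ (det-cong same) ⟩
      sgn (suc j) * a * det (λ i l → minor A (punchIn k j) i (toFront (position k j) l))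
        ≈⟨ *-congˡ (det-toFront (minor A (punchIn k j)) (position k j)) ⟩
      sgn (suc j) * a * (sgn (position k j) * d)
        ≈⟨ solve 4 (λ s a p d → s :* a :* (p :* d) := s :* p :* (a :* d))
            refl (sgn (suc j)) a (sgn (position k j)) d ⟩
      sgn (suc j) * sgn (position k j) * (a * d)
        ≈⟨ *-congʳ (sgn-position k j) ⟩
      sgn k * sgn (punchIn k j) * (a * d)
        ≈⟨ solve 4 (λ s a p d → s :* p :* (a :* d) := s :* (p :* a :* d)) refl (sgn k) a (sgn (punchIn k j)) d ⟩
      sgn k * (sgn (punchIn k j) * a * d) ∎
      where
      a = A zero (punchIn k j)
      d = det (minor A (punchIn k j))
      same : (λ i l → A (suc i) (toFront k (punchIn (suc j) l))) ≋
          (λ i l → minor A (punchIn k j) i (toFront (position k j) l))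
      same i zero    = reflexive (≡.cong (A (suc i)) (≡.sym (punchIn-position k j)))
      same i (suc l) = reflexive (≡.cong (A (suc i)) (≡.sym (punchIn-punchIn k j l)))

  sgn-cancel : (k : Fin n) {x y : Carrier} → sgn k * x ≈ sgn k * y → x ≈ y
  sgn-cancel k {x} {y} sx≈sy = begin
    x                     ≈⟨ lemma x ⟨
    sgn k * (sgn k * x)   ≈⟨ *-congˡ sx≈sy ⟩
    sgn k * (sgn k * y)   ≈⟨ lemma y ⟩
    y                     ∎
    where
    lemma : ∀ x → sgn k * (sgn k * x) ≈ x
    lemma x = trans (sym (*-assoc _ _ _)) (trans (*-congʳ (sgn*sgn k)) (*-identityˡ x))

  det-equalColumns : (A : Matrix (suc n) (suc n)) (k : Fin n) → (∀ i → A i zero ≈ A i (suc k)) → det A ≈ 0#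
  det-equalColumns {suc n} A k A₀≈Aₖ = sgn-cancel (suc k) (begin
    sgn (suc k) * det A                       ≈⟨ det-toFront A (suc k) ⟨
    det (λ i j → A i (toFront (suc k) j))
      ≈⟨ det-equalColumns₀₁ (λ i j → A i (toFront (suc k) j)) (λ i → sym (A₀≈Aₖ i)) ⟩
    0#                                        ≈⟨ zeroʳ _ ⟨
    sgn (suc k) * 0#                          ∎)

  det-addColumn : (u : Vector Carrier (suc (suc n))) (M N : Matrix (suc (suc n)) (suc n)) →
                  (k : Fin (suc n)) (c : Carrier) →
                  (∀ i → N i k ≈ M i k + c * u i) → (∀ i j → N i (punchIn k j) ≈ M i (punchIn k j)) →
                  det (u ∣ N) ≈ det (u ∣ M)
  det-addColumn {n} u M N k c Nₖ≈ Nⱼ≈ = sgn-cancel (suc k) (begin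
    sgn (suc k) * det (u ∣ N)                    ≈⟨ det-toFront (u ∣ N) (suc k) ⟨
    det (λ i j → (u ∣ N) i (toFront (suc k) j))  ≈⟨ det-cong N≋ ⟩
    det ((λ i → 1# * M i k + c * u i) ∣ X)       ≈⟨ det-linear 1# c (λ i → M i k) u X ⟩
    1# * det (Mₖ ∣ X) + c * det (u ∣ X)          ≈⟨ +-congˡ (*-congˡ (det-equalColumns₀₁ (u ∣ X) λ i → refl)) ⟩
    1# * det (Mₖ ∣ X) + c * 0#
      ≈⟨ solve 2 (λ d c → con (+ 1) :* d :+ c :* con (+ 0) := d) refl (det (Mₖ ∣ X)) c ⟩
    det (Mₖ ∣ X)
      ≈⟨ det-cong {A = Mₖ ∣ X} {λ i j → (u ∣ M) i (toFront (suc k) j)}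
          (λ { i zero → refl ; i (suc zero) → refl ; i (suc (suc j)) → refl }) ⟩
    det (λ i j → (u ∣ M) i (toFront (suc k) j))  ≈⟨ det-toFront (u ∣ M) (suc k) ⟩
    sgn (suc k) * det (u ∣ M)                    ∎)
    where
    Mₖ = λ i → M i k
    X : Matrix (suc (suc n)) (suc n)
    X = u ∣ λ i → removeAt (M i) k
    N≋ : (λ i j → (u ∣ N) i (toFront (suc k) j)) ≋ ((λ i → 1# * M i k + c * u i) ∣ X)
    N≋ i zero          = trans (Nₖ≈ i) (+-congʳ (sym (*-identityˡ _)))
    N≋ i (suc zero)    = refl
    N≋ i (suc (suc j)) = Nⱼ≈ i j

  -- A property of vectors holds everywhere if it holds at 0 and holds at c
  -- whenever it holds at c with one coordinate replaced by 0.
  coordinateInduction : ∀ {p} (P : Vector Carrier n → Set p) →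
    (∀ {c d} → (∀ i → c i ≈ d i) → P c → P d) →
    P (λ _ → 0#) → (∀ k c → P (updateAt c k (const 0#)) → P c) → ∀ c → P c
  coordinateInduction {zero}  P resp base step c = resp (λ ()) base
  coordinateInduction {suc n} P resp base step c =
    step zero c (resp (λ { zero → refl ; (suc i) → refl })
      (coordinateInduction (λ d → P (0# ∷ d)) resp′ base′ step′ λ i → c (suc i)))
    where
    resp′ : ∀ {c d : Vector Carrier n} → (∀ i → c i ≈ d i) → P (0# ∷ c) → P (0# ∷ d)
    resp′ c≈d = resp λ { zero → refl ; (suc i) → c≈d i }
    base′ : P (0# ∷ λ _ → 0#)
    base′ = resp (λ { zero → refl ; (suc i) → refl }) base
    step′ : ∀ k (c : Vector Carrier n) → P (0# ∷ updateAt c k (const 0#)) → P (0# ∷ c)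
    step′ k c Pc = step (suc k) (0# ∷ c) (resp (λ { zero → refl ; (suc i) → refl }) Pc)

  updateAt-same : (c : Vector Carrier n) (k : Fin n) {x : Carrier} → updateAt c k (const x) k ≡ x
  updateAt-same {suc n} c zero    = ≡.refl
  updateAt-same {suc n} c (suc k) = updateAt-same (λ i → c (suc i)) k

  updateAt-punchIn : (c : Vector Carrier (suc n)) (k : Fin (suc n)) {x : Carrier} (j : Fin n) →
                     updateAt c k (const x) (punchIn k j) ≡ c (punchIn k j)
  updateAt-punchIn         c zero    j       = ≡.refl
  updateAt-punchIn {suc n} c (suc k) zero    = ≡.refl
  updateAt-punchIn {suc n} c (suc k) (suc j) = updateAt-punchIn (λ i → c (suc i)) k j

  det-addColumns : (u : Vector Carrier (suc n)) (M : Matrix (suc n) n) (c : Vector Carrier n) →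
                   det (u ∣ λ i j → M i j + c j * u i) ≈ det (u ∣ M)
  det-addColumns {n} u M = coordinateInduction (λ c → det (u ∣ add c) ≈ det (u ∣ M))
    (λ {c} {d} c≈d → trans (det-cong {A = u ∣ add d} {u ∣ add c}
      (∣-cong (λ _ → refl) λ i j → +-congˡ {M i j} (*-congʳ {u i} (sym (c≈d j))))))
    (det-cong {A = u ∣ add (λ _ → 0#)} {u ∣ M}
      (∣-cong (λ _ → refl) λ i j → trans (+-congˡ (zeroˡ (u i))) (+-identityʳ (M i j))))
    (step n u M)
    where
    add : Vector Carrier n → Matrix (suc n) n
    add c i j = M i j + c j * u i
    step : ∀ n u M (k : Fin n) c →
      det (u ∣ λ i j → M i j + updateAt c k (const 0#) j * u i) ≈ det (u ∣ M) →
      det (u ∣ λ i j → M i j + c j * u i) ≈ det (u ∣ M)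
    step (suc n) u M k c = trans (det-addColumn u
      (λ i j → M i j + updateAt c k (const 0#) j * u i) (λ i j → M i j + c j * u i) k (c k)
      (λ i → trans (solve 3 (λ m c u → m :+ c :* u := m :+ con (+ 0) :* u :+ c :* u) refl (M i k) (c k) (u i))
        (+-congʳ (+-congˡ {M i k} (*-congʳ {u i} (reflexive (≡.sym (updateAt-same c k)))))))
      (λ i j → +-congˡ {M i (punchIn k j)} (*-congʳ {u i} (reflexive (≡.sym (updateAt-punchIn c k j))))))

  det-sumColumn : (w : Matrix (suc n) m) (B : Matrix (suc n) n) →
                  det ((λ i → sum (w i)) ∣ B) ≈ sum λ j → det ((λ i → w i j) ∣ B)
  det-sumColumn {m = zero}  w B = det-zeroColumn ((λ i → 0#) ∣ B) λ i → refl
  det-sumColumn {m = suc m} w B = begin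
    det ((λ i → sum (w i)) ∣ B)
      ≈⟨ det-cong {A = (λ i → sum (w i)) ∣ B} {(λ i → 1# * w i zero + 1# * w′ i) ∣ B} (∣-cong
           (λ i → solve 2 (λ a b → a :+ b := con (+ 1) :* a :+ con (+ 1) :* b) refl (w i zero) (w′ i))
               λ i j → refl) ⟩
    det ((λ i → 1# * w i zero + 1# * w′ i) ∣ B)
      ≈⟨ det-linear 1# 1# (λ i → w i zero) w′ B ⟩
    1# * det ((λ i → w i zero) ∣ B) + 1# * det (w′ ∣ B)
      ≈⟨ +-cong (*-identityˡ _) (trans (*-identityˡ _) (det-sumColumn (λ i j → w i (suc j)) B)) ⟩
    sum (λ j → det ((λ i → w i j) ∣ B)) ∎
    where
    w′ = λ i → sum λ j → w i (suc j)

  -- Adding all columns to the first one replaces it by the row sums.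
  det-rowSums : (A : Matrix (suc n) (suc n)) → det A ≈ det ((λ i → sum (A i)) ∣ λ i j → A i (suc j))
  det-rowSums A = sym (begin
    det ((λ i → sum (A i)) ∣ B)                                      ≈⟨ det-sumColumn A B ⟩
    det ((λ i → A i zero) ∣ B) + sum (λ j → det ((λ i → B i j) ∣ B))
      ≈⟨ +-cong (det-cong {A = (λ i → A i zero) ∣ B} {A} (λ { i zero → refl ; i (suc j) → refl }))
           (sum-zero {f = λ j → det ((λ i → B i j) ∣ B)} λ j → det-equalColumns ((λ i → B i j) ∣ B) j
               λ i → refl) ⟩
    det A + 0#                                                       ≈⟨ +-identityʳ _ ⟩
    det A                                                            ∎)
    where
    B = λ i j → A i (suc j)

  det-scale : ∀ a (A : Matrix n n) → det (λ i j → a * A i j) ≈ a ^ n * det A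
  det-scale {zero}  a A = sym (*-identityˡ 1#)
  det-scale {suc n} a A = begin
    sum (λ j → sgn j * (a * A zero j) * det (λ i k → a * minor A j i k))
      ≈⟨ sum-cong-≋ (λ j → trans (*-congˡ (det-scale a (minor A j)))
           (solve 5 (λ s a b p d → s :* (a :* b) :* (p :* d) := a :* p :* (s :* b :* d))
               refl (sgn j) a (A zero j) (a ^ n) (det (minor A j)))) ⟩
    sum (λ j → a * a ^ n * (sgn j * A zero j * det (minor A j)))
      ≈⟨ *-distribˡ-sum (a * a ^ n) (λ j → sgn j * A zero j * det (minor A j)) ⟨
    a * a ^ n * det A ∎

-- Polynomial functions, continuity and the trace
module Polynomial {c ℓ₁ ℓ₂} (ℝ : RealField c ℓ₁ ℓ₂) where

  open RealAlgebra ℝ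
  open Order ℝ
  open Determinant ℝ

  private variable
    n : ℕ
    f g : Carrier → Carrier
    a b a′ b′ : Carrier

  -- The functions built from constants and the argument by sums and products.
  data IsPolynomial : (Carrier → Carrier) → Set (c ⊔ ℓ₁) where
    constant : ∀ a → IsPolynomial (λ _ → a)
    indeterminate : IsPolynomial (λ x → x)
    _⊞_ : IsPolynomial f → IsPolynomial g → IsPolynomial (λ x → f x + g x)
    _⊠_ : IsPolynomial f → IsPolynomial g → IsPolynomial (λ x → f x * g x)

  infixl 6 _⊞_
  infixl 7 _⊠_

  compose : IsPolynomial f → IsPolynomial g → IsPolynomial (λ x → f (g x))
  compose (constant a)  r = constant a
  compose indeterminate r = r
  compose (p ⊞ q)       r = compose p r ⊞ compose q r
  compose (p ⊠ q)       r = compose p r ⊠ compose q r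

  divide : IsPolynomial f → ∃[ g ] IsPolynomial g × (∀ x → f x ≈ f 0# + x * g x)
  divide (constant a) = (λ _ → 0#) , constant 0# , λ x → solve 2 (λ a x → a := a :+ x :* con (+ 0)) refl a x
  divide indeterminate = (λ _ → 1#) , constant 1# , λ x → solve 1 (λ x → x := con (+ 0) :+ x :* con (+ 1))
      refl x
  divide (_⊞_ {f} {g} p q) with divide p | divide q
  ... | f′ , p′ , f≈ | g′ , q′ , g≈ = _ , p′ ⊞ q′ , λ x →
    trans (+-cong (f≈ x) (g≈ x)) (solve 5 (λ a b x f g → (a :+ x :* f) :+ (b :+ x :* g) :=
        (a :+ b) :+ x :* (f :+ g)) refl (f 0#) (g 0#) x (f′ x) (g′ x))
  divide (_⊠_ {f} {g} p q) with divide p | divide q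
  ... | f′ , p′ , f≈ | g′ , q′ , g≈ = _ , p′ ⊠ q ⊞ constant (f 0#) ⊠ q′ , λ x → begin
    f x * g x                               ≈⟨ *-congʳ (f≈ x) ⟩
    (f 0# + x * f′ x) * g x
      ≈⟨ solve 4 (λ a x f g → (a :+ x :* f) :* g := a :* g :+ x :* (f :* g)) refl (f 0#) x (f′ x) (g x) ⟩
    f 0# * g x + x * (f′ x * g x)           ≈⟨ +-congʳ (*-congˡ (g≈ x)) ⟩
    f 0# * (g 0# + x * g′ x) + x * (f′ x * g x)
      ≈⟨ solve 5 (λ a b x h g′ → a :* (b :+ x :* g′) :+ x :* h := a :* b :+ x :* (h :+ a :* g′))
          refl (f 0#) (g 0#) x (f′ x * g x) (g′ x) ⟩
    f 0# * g 0# + x * (f′ x * g x + f 0# * g′ x) ∎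

  -- x lies between -B and B.
  Within : Carrier → Carrier → Set _
  Within B x = 0# ≤ B - x × 0# ≤ B + x

  Within-+ : ∀ {B C x y} → Within B x → Within C y → Within (B + C) (x + y)
  Within-+ {B} {C} {x} {y} (p , q) (r , s) =
    ≤-resp refl (solve 4 (λ B C x y → (B :- x) :+ (C :- y) := B :+ C :- (x :+ y)) refl B C x y) (0≤+ p r) ,
    ≤-resp refl (solve 4 (λ B C x y → (B :+ x) :+ (C :+ y) := B :+ C :+ (x :+ y)) refl B C x y) (0≤+ q s)

  Within-* : ∀ {B C x y} → Within B x → Within C y → Within (B * C) (x * y)
  Within-* {B} {C} {x} {y} (p , q) (r , s) =
    0≤x+x⇒0≤x (≤-resp refl (solve 4 (λ B C x y → (B :- x) :* (C :+ y) :+ (B :+ x) :* (C :- y) :=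
        (B :* C :- x :* y) :+ (B :* C :- x :* y)) refl B C x y)
      (0≤+ (0≤* p s) (0≤* q r))) ,
    0≤x+x⇒0≤x (≤-resp refl (solve 4 (λ B C x y → (B :+ x) :* (C :+ y) :+ (B :- x) :* (C :- y) :=
        (B :* C :+ x :* y) :+ (B :* C :+ x :* y)) refl B C x y)
      (0≤+ (0≤* q s) (0≤* p r)))

  bounded : IsPolynomial f → ∃[ B ] (∀ x → 0# ≤ x → x ≤ 1# → Within B (f x))
  -- The bound on a constant comes from  2 (a² + 1 ± a) = (a ± 1)² + a² + 1.
  bounded (constant a) = a * a + 1# , λ x 0≤x x≤1 →
      0≤x+x⇒0≤x (≤-resp refl (solve 1 (λ a → (a :- con (+ 1)) :* (a :- con (+ 1)) :+ (a :* a :+ con (+ 1)) :=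
          (a :* a :+ con (+ 1) :- a) :+ (a :* a :+ con (+ 1) :- a)) refl a)
        (0≤+ (0≤sq (a - 1#)) 0≤a*a+1)) ,
      0≤x+x⇒0≤x (≤-resp refl (solve 1 (λ a → (a :+ con (+ 1)) :* (a :+ con (+ 1)) :+ (a :* a :+ con (+ 1)) :=
          (a :* a :+ con (+ 1) :+ a) :+ (a :* a :+ con (+ 1) :+ a)) refl a)
        (0≤+ (0≤sq (a + 1#)) 0≤a*a+1))
    where
    0≤a*a+1 : 0# ≤ a * a + 1#
    0≤a*a+1 = 0≤+ (0≤sq a) (<⇒≤ 0<1#)
  bounded indeterminate = 1# , λ x 0≤x x≤1 → x≤y⇒0≤y-x x≤1 , 0≤+ (<⇒≤ 0<1#) 0≤x
  bounded (p ⊞ q) with bounded p | bounded q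
  ... | B , f-within | C , g-within = B + C , λ x 0≤x x≤1 → Within-+ (f-within x 0≤x x≤1) (g-within x 0≤x x≤1)
  bounded (p ⊠ q) with bounded p | bounded q
  ... | B , f-within | C , g-within = B * C , λ x 0≤x x≤1 → Within-* (f-within x 0≤x x≤1) (g-within x 0≤x x≤1)

  Within⇒0≤ : ∀ {B x} → Within B x → 0# ≤ B
  Within⇒0≤ {B} {x} (p , q) = 0≤x+x⇒0≤x (≤-resp
      refl (solve 2 (λ B x → (B :- x) :+ (B :+ x) := B :+ B) refl B x) (0≤+ p q))

  -- Write f(x) = f(0) + x g(x) with g at least -B on [0,1].  If e = f(0) were
  -- positive, then f would be positive at the point e / (B + e).
  vanishing⇒¬positive : IsPolynomial f → (∀ x → 0# < x → f x ≈ 0#) → ¬ (0# < f 0#)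
  vanishing⇒¬positive {f} p f≈0 0<f0 with divide p
  ... | g , q , f≈ with bounded q
  ... | B , g-within = <⇒≉ 0<fy (sym (f≈0 y 0<y))
    where
    e = f 0#
    0≤B : 0# ≤ B
    0≤B = Within⇒0≤ (g-within 0# (≤-reflexive refl) (<⇒≤ 0<1#))
    0<B+e : 0# < B + e
    0<B+e = <-≤-trans 0<f0 (0≤y-x⇒x≤y (≤-resp refl (solve 2 (λ B e → B := B :+ e :- e) refl B e) 0≤B))
    i = proj₁ (inverse (inj₂ 0<B+e))
    [B+e]*i≈1 : (B + e) * i ≈ 1#
    [B+e]*i≈1 = proj₂ (inverse (inj₂ 0<B+e))
    0<i : 0# < i
    0<i = inverse-pos 0<B+e [B+e]*i≈1
    y = e * i
    0<y : 0# < y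
    0<y = *-pos 0<f0 0<i
    y≤1 : y ≤ 1#
    y≤1 = 0≤y-x⇒x≤y (≤-resp refl (trans (solve 3 (λ B e i → B :* i := (B :+ e) :* i :- e :* i) refl B e i)
        (+-congʳ [B+e]*i≈1)) (0≤* 0≤B (<⇒≤ 0<i)))
    e-y*B≈ : e - y * B ≈ e * y
    e-y*B≈ = begin
      e - e * i * B                  ≈⟨ +-congʳ (trans (sym (*-identityʳ e)) (*-congˡ (sym [B+e]*i≈1))) ⟩
      e * ((B + e) * i) - e * i * B
        ≈⟨ solve 3 (λ B e i → e :* ((B :+ e) :* i) :- e :* i :* B := e :* (e :* i)) refl B e i ⟩
      e * (e * i)                    ∎
    0<fy : 0# < f y
    0<fy = <-≤-trans (<-resp refl (sym e-y*B≈) (*-pos 0<f0 0<y))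
      (0≤y-x⇒x≤y (≤-resp refl (trans (solve 4 (λ e y B g → y :* (B :+ g) := (e :+ y :* g) :- (e :- y :* B))
          refl e y B (g y)) (+-congʳ (sym (f≈ y))))
        (0≤* (<⇒≤ 0<y) (proj₂ (g-within y (<⇒≤ 0<y) y≤1)))))

  vanishing-at-0 : IsPolynomial f → (∀ x → 0# < x → f x ≈ 0#) → f 0# ≈ 0#
  vanishing-at-0 {f} p f≈0 = sq≈0⇒≈0 (≈-stable λ f0*f0≉0 →
    0≤-cases (0≤sq (f 0#)) λ
      { (inj₁ 0≈) → f0*f0≉0 (sym 0≈)
      ; (inj₂ 0<) → vanishing⇒¬positive (p ⊠ p) (λ x 0<x → trans (*-congʳ (f≈0 x 0<x)) (zeroˡ _)) 0< })

  poly-cong : IsPolynomial f → ∀ {x y} → x ≈ y → f x ≈ f y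
  poly-cong (constant a)  x≈y = refl
  poly-cong indeterminate x≈y = x≈y
  poly-cong (p ⊞ q)       x≈y = +-cong (poly-cong p x≈y) (poly-cong q x≈y)
  poly-cong (p ⊠ q)       x≈y = *-cong (poly-cong p x≈y) (poly-cong q x≈y)

  -- Continuity from the right: if f vanishes on all x > a, then also at a.
  vanishing-at : IsPolynomial f → ∀ a → (∀ x → a < x → f x ≈ 0#) → f a ≈ 0#
  vanishing-at {f} p a f≈0 = trans (poly-cong p (sym (+-identityʳ a)))
    (vanishing-at-0 (compose p (constant a ⊞ indeterminate)) λ x 0<x → f≈0 (a + x)
      (0<y-x⇒x<y (<-resp refl (solve 2 (λ a x → x := a :+ x :- a) refl a x) 0<x)))

  sum-polynomial : {f : Fin n → Carrier → Carrier} → (∀ i → IsPolynomial (f i)) →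
    IsPolynomial (λ x → sum λ i → f i x)
  sum-polynomial {zero}  p = constant 0#
  sum-polynomial {suc n} p = p zero ⊞ sum-polynomial λ i → p (suc i)

  product-polynomial : {f : Fin n → Carrier → Carrier} → (∀ i → IsPolynomial (f i)) →
    IsPolynomial (λ x → product λ i → f i x)
  product-polynomial {zero}  p = constant 1#
  product-polynomial {suc n} p = p zero ⊠ product-polynomial λ i → p (suc i)

  det-polynomial : {A : Fin n → Fin n → Carrier → Carrier} → (∀ i j → IsPolynomial (A i j)) →
                   IsPolynomial (λ x → det λ i j → A i j x)
  det-polynomial {zero}  p = constant 1#
  det-polynomial {suc n} p = sum-polynomial λ j →
    constant (sgn j) ⊠ p zero j ⊠ det-polynomial λ i k → p (suc i) (punchIn j k)

  -- f agrees with the polynomial a + b x up to a polynomial multiple of x².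
  Jet : (Carrier → Carrier) → Carrier → Carrier → Set _
  Jet f a b = ∃[ g ] IsPolynomial g × (∀ x → f x ≈ a + x * b + x * x * g x)

  Jet-resp : (∀ x → f x ≈ g x) → a ≈ a′ → b ≈ b′ → Jet f a b → Jet g a′ b′
  Jet-resp f≈g a≈a′ b≈b′ (h , p , f≈) = h , p , λ x →
    trans (sym (f≈g x)) (trans (f≈ x) (+-congʳ (+-cong a≈a′ (*-congˡ b≈b′))))

  Jet-1+ : ∀ b → Jet (λ x → 1# + x * b) 1# b
  Jet-1+ b = (λ _ → 0#) , constant 0# , λ x → solve 2 (λ x b → con (+ 1) :+ x :* b :=
      con (+ 1) :+ x :* b :+ x :* x :* con (+ 0)) refl x b

  Jet-+ : Jet f a b → Jet g a′ b′ → Jet (λ x → f x + g x) (a + a′) (b + b′)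
  Jet-+ {a = a} {b} {a′ = a′} {b′} (f′ , p , f≈) (g′ , q , g≈) = _ , p ⊞ q , λ x →
    trans (+-cong (f≈ x) (g≈ x)) (solve 7 (λ a b a′ b′ x f g →
      (a :+ x :* b :+ x :* x :* f) :+ (a′ :+ x :* b′ :+ x :* x :* g) :=
          (a :+ a′) :+ x :* (b :+ b′) :+ x :* x :* (f :+ g)) refl a b a′ b′ x (f′ x) (g′ x))

  Jet-* : Jet f a b → Jet g a′ b′ → Jet (λ x → f x * g x) (a * a′) (a * b′ + b * a′)
  Jet-* {a = a} {b} {a′ = a′} {b′} (f′ , p , f≈) (g′ , q , g≈) =
    _ , p ⊠ (constant a′ ⊞ indeterminate ⊠ constant b′ ⊞ indeterminate ⊠ indeterminate ⊠ q)
        ⊞ constant b ⊠ (constant b′ ⊞ indeterminate ⊠ q) ⊞ constant a ⊠ q , λ x →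
    trans (*-cong (f≈ x) (g≈ x)) (solve 7 (λ a b a′ b′ x f g →
      (a :+ x :* b :+ x :* x :* f) :* (a′ :+ x :* b′ :+ x :* x :* g) :=
      a :* a′ :+ x :* (a :* b′ :+ b :* a′) :+ x :* x :* (f :* (a′ :+ x :* b′ :+ x :* x :* g)
          :+ b :* (b′ :+ x :* g) :+ a :* g)) refl a b a′ b′ x (f′ x) (g′ x))

  Jet-product : (b : Vector Carrier n) → Jet (λ x → product λ i → 1# + x * b i) 1# (sum b)
  Jet-product {zero} b = (λ _ → 0#) , constant 0# , λ x → solve 1 (λ x → con (+ 1) :=
      con (+ 1) :+ x :* con (+ 0) :+ x :* x :* con (+ 0)) refl x
  Jet-product {suc n} b = Jet-resp (λ x → refl) (*-identityˡ 1#)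
    (solve 2 (λ s b → con (+ 1) :* s :+ b :* con (+ 1) := b :+ s) refl (sum λ i → b (suc i)) (b zero))
    (Jet-* (Jet-1+ (b zero)) (Jet-product λ i → b (suc i)))

  Jet-sum-0 : {f : Fin n → Carrier → Carrier} → (∀ i → Jet (f i) 0# 0#) → Jet (λ x → sum λ i → f i x) 0# 0#
  Jet-sum-0 {zero}  jets = (λ _ → 0#) , constant 0# , λ x → solve 1 (λ x → con (+ 0) :=
      con (+ 0) :+ x :* con (+ 0) :+ x :* x :* con (+ 0)) refl x
  Jet-sum-0 {suc n} jets = Jet-resp (λ x → refl) (+-identityˡ 0#) (+-identityˡ 0#)
    (Jet-+ (jets zero) (Jet-sum-0 λ i → jets (suc i)))

  -- The matrix I + xM.
  I+ : Matrix n n → Carrier → Matrix n n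
  I+ M x i j = identity i j + x * M i j

  I+-polynomial : (M : Matrix n n) → ∀ i j → IsPolynomial (λ x → I+ M x i j)
  I+-polynomial M i j = constant (identity i j) ⊞ indeterminate ⊠ constant (M i j)

  -- The minor of I + xM at the first row and the column after column j.
  I+-minor : Matrix (suc n) (suc n) → Fin n → Carrier → Carrier
  I+-minor M j x = det (minor (I+ M x) (suc j))

  I+-minor-polynomial : (M : Matrix (suc n) (suc n)) (j : Fin n) → IsPolynomial (I+-minor M j)
  I+-minor-polynomial M j = det-polynomial {A = λ i k x → minor (I+ M x) (suc j) i k} λ i k → I+-polynomial M
      (suc i) (punchIn (suc j) k)

  I+-minor-0 : (M : Matrix (suc n) (suc n)) (j : Fin n) → I+-minor M j 0# ≈ 0#
  I+-minor-0 {suc n} M j = det-zeroColumn (minor (I+ M 0#) (suc j)) λ i → trans (+-identityˡ _) (zeroˡ _)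

  -- An off-diagonal entry of the first row of I + xM is divisible by x, and so
  -- is its minor, whose first column vanishes at x = 0.
  Jet-I+-minor : (M : Matrix (suc n) (suc n)) (j : Fin n) →
                 Jet (λ x → sgn (suc j) * (0# + x * M zero (suc j)) * I+-minor M j x) 0# 0#
  Jet-I+-minor M j with divide (I+-minor-polynomial M j)
  ... | g , p , d≈ = (λ x → s * m * g x) , constant (s * m) ⊠ p , λ x → begin
    s * (0# + x * m) * d x               ≈⟨ *-congˡ (d≈ x) ⟩
    s * (0# + x * m) * (d 0# + x * g x)  ≈⟨ *-congˡ (+-congʳ (I+-minor-0 M j)) ⟩
    s * (0# + x * m) * (0# + x * g x)
      ≈⟨ solve 4 (λ s x m g → s :* (con (+ 0) :+ x :* m) :* (con (+ 0) :+ x :* g) :=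
          con (+ 0) :+ x :* con (+ 0) :+ x :* x :* (s :* m :* g)) refl s x m (g x) ⟩
    0# + x * 0# + x * x * (s * m * g x)  ∎
    where
    d = I+-minor M j
    s = sgn (suc j)
    m = M zero (suc j)

  -- The determinant of I + xM is 1 + x tr M up to order x².
  Jet-det : (M : Matrix n n) → Jet (λ x → det (I+ M x)) 1# (sum λ i → M i i)
  Jet-det {zero} M = (λ _ → 0#) , constant 0# , λ x → solve 1 (λ x → con (+ 1) :=
      con (+ 1) :+ x :* con (+ 0) :+ x :* x :* con (+ 0)) refl x
  Jet-det {suc n} M = Jet-resp
    {f = λ x → first x + sum λ j → rest j x}
    {g = λ x → det (I+ M x)}
    (λ x → refl) (trans (+-identityʳ _) (*-identityʳ 1#))
    (solve 2 (λ b t → con (+ 1) :* t :+ b :* con (+ 1) :+ con (+ 0) := b :+ t)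
        refl (M zero zero) (sum λ i → M (suc i) (suc i)))
    (Jet-+ {f = first} {g = λ x → sum λ j → rest j x} Jet-first (Jet-sum-0 {f = rest} (Jet-I+-minor M)))
    where
    M′ : Matrix n n
    M′ i j = M (suc i) (suc j)
    first : Carrier → Carrier
    first x = 1# * (1# + x * M zero zero) * det (I+ M′ x)
    rest : Fin n → Carrier → Carrier
    rest j x = sgn (suc j) * (0# + x * M zero (suc j)) * I+-minor M j x
    Jet-first : Jet first (1# * 1#) (1# * sum (λ i → M′ i i) + M zero zero * 1#)
    Jet-first = Jet-* {f = λ x → 1# * (1# + x * M zero zero)} {g = λ x → det (I+ M′ x)}
      (Jet-resp {f = λ x → 1# + x * M zero zero} {g = λ x → 1# * (1# + x * M zero zero)}
          (λ x → sym (*-identityˡ _)) refl refl (Jet-1+ (M zero zero)))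
      (Jet-det M′)

  Jet-unique : Jet f a b → Jet g a b′ → (∀ x → 0# < x → f x ≈ g x) → b ≈ b′
  Jet-unique {f} {a} {b} {g} {b′} (f′ , p , f≈) (g′ , q , g≈) f≈g = begin
    b
      ≈⟨ solve 4 (λ b b′ f g → b := b′ :+ (b :+ con -[1+ 0 ] :* b′ :+ con (+ 0) :* (f :+ con -[1+ 0 ] :* g)))
          refl b b′ (f′ 0#) (g′ 0#) ⟩
    b′ + h 0#
      ≈⟨ +-congˡ (vanishing-at-0 (constant b ⊞ constant (- 1#) ⊠ constant b′ ⊞ indeterminate ⊠
          (p ⊞ constant (- 1#) ⊠ q)) h≈0) ⟩
    b′ + 0#              ≈⟨ +-identityʳ b′ ⟩
    b′                   ∎
    where
    h : Carrier → Carrier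
    h x = b + - 1# * b′ + x * (f′ x + - 1# * g′ x)
    h≈0 : ∀ x → 0# < x → h x ≈ 0#
    h≈0 x 0<x = *-cancelˡ-0 (inj₂ 0<x) (begin
      x * h x
        ≈⟨ solve 6 (λ a b b′ x f g → x :* (b :+ con -[1+ 0 ] :* b′ :+ x :* (f :+ con -[1+ 0 ] :* g)) :=
             (a :+ x :* b :+ x :* x :* f) :- (a :+ x :* b′ :+ x :* x :* g)) refl a b b′ x (f′ x) (g′ x) ⟩
      (a + x * b + x * x * f′ x) - (a + x * b′ + x * x * g′ x)   ≈⟨ +-cong (sym (f≈ x)) (-‿cong (sym (g≈ x))) ⟩
      f x - g x                                                  ≈⟨ +-congʳ (f≈g x 0<x) ⟩
      g x - g x                                                  ≈⟨ -‿inverseʳ _ ⟩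
      0#                                                         ∎)

  product-scale : ∀ a (f : Vector Carrier n) → product (λ i → a * f i) ≈ a ^ n * product f
  product-scale {zero}  a f = sym (*-identityˡ 1#)
  product-scale {suc n} a f = trans (*-congˡ (product-scale a λ i → f (suc i)))
    (solve 4 (λ a b p q → a :* b :* (p :* q) := a :* p :* (b :* q))
        refl a (f zero) (a ^ n) (product λ i → f (suc i)))

  product-cong : {f g : Vector Carrier n} → (∀ i → f i ≈ g i) → product f ≈ product g
  product-cong {zero}  f≈g = refl
  product-cong {suc n} f≈g = *-cong (f≈g zero) (product-cong λ i → f≈g (suc i))

  sum-neg : (f : Vector Carrier n) → sum (λ i → - f i) ≈ - sum f
  sum-neg f = begin
    sum (λ i → - f i)
      ≈⟨ sum-linear (- 1#) 0# (λ i → solve 1 (λ x → :- x := con -[1+ 0 ] :* x :+ con (+ 0) :* x) refl (f i)) ⟩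
    - 1# * sum f + 0# * sum f
      ≈⟨ solve 1 (λ x → con -[1+ 0 ] :* x :+ con (+ 0) :* x := :- x) refl (sum f) ⟩
    - sum f                            ∎

  -- With y = 1 / x, multiplication by yⁿ turns the two sides of
  -- det (xI - A) = ∏ (x - λᵢ)  into  det (I - yA)  and  ∏ (1 - yλᵢ);  then the
  -- coefficients of y are compared.
  sum-spectrum≈trace : (A : Matrix n n) (λs : Vector Carrier n) → HasSpectrum A λs → sum λs ≈ sum (λ i → A i i)
  sum-spectrum≈trace {n} A λs spectrum = begin
    sum λs                       ≈⟨ solve 1 (λ x → x := :- (:- x)) refl (sum λs) ⟩
    - - sum λs                   ≈⟨ -‿cong (sum-neg λs) ⟨
    - sum (λ i → - λs i)
      ≈⟨ -‿cong (Jet-unique (Jet-product λ i → - λs i) (Jet-det λ i j → - A i j) same) ⟩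
    - sum (λ i → - A i i)        ≈⟨ -‿cong (sum-neg λ i → A i i) ⟩
    - - sum (λ i → A i i)        ≈⟨ solve 1 (λ x → :- (:- x) := x) refl (sum λ i → A i i) ⟩
    sum (λ i → A i i)            ∎
    where
    same : ∀ y → 0# < y → product (λ i → 1# + y * - λs i) ≈ det λ i j → identity i j + y * - A i j
    same y 0<y with inverse (inj₂ 0<y)
    ... | x , y*x≈1 = begin
      product (λ i → 1# + y * - λs i)
        ≈⟨ product-cong (λ i → trans (+-congʳ (sym y*x≈1)) (solve 3 (λ y x l → y :* x :+ y :* (:- l) :=
            y :* (x :- l)) refl y x (λs i))) ⟩
      product (λ i → y * (x - λs i))               ≈⟨ product-scale y (λ i → x - λs i) ⟩
      y ^ n * product (λ i → x - λs i)             ≈⟨ *-congˡ (spectrum x) ⟨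
      y ^ n * charPoly A x                         ≈⟨ det-scale y (λ i j → x * identity i j - A i j) ⟨
      det (λ i j → y * (x * identity i j - A i j)) ≈⟨ det-cong (λ i j → trans
        (solve 4 (λ y x e a → y :* (x :* e :- a) := y :* x :* e :+ y :* (:- a)) refl y x (identity i j) (A i j))
        (+-congʳ (trans (*-congʳ y*x≈1) (*-identityˡ _)))) ⟩
      det (λ i j → identity i j + y * - A i j)     ∎

-- Quadratic forms and nonvanishing determinants
module QuadraticForm {c ℓ₁ ℓ₂} (ℝ : RealField c ℓ₁ ℓ₂) where

  open RealAlgebra ℝ
  open Order ℝ
  open Determinant ℝ

  private variable
    n : ℕ

  -- The scalar product.
  infixl 7 _∙_
  _∙_ : Vector Carrier n → Vector Carrier n → Carrier
  u ∙ v = sum λ i → u i * v i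

  -- The quadratic form vᵀMv.
  form : Matrix n n → Vector Carrier n → Carrier
  form M v = v ∙ λ i → M i ∙ v

  ∙-nonneg : (v : Vector Carrier n) → 0# ≤ v ∙ v
  ∙-nonneg v = sum-nonneg (λ i → v i * v i) λ i → 0≤sq (v i)

  identity-∙ : (i : Fin n) (v : Vector Carrier n) → identity i ∙ v ≈ v i
  identity-∙ zero v = begin
    1# * v zero + sum (λ j → 0# * v (suc j))   ≈⟨ +-cong (*-identityˡ _) (sum-zero λ j → zeroˡ (v (suc j))) ⟩
    v zero + 0#                                ≈⟨ +-identityʳ _ ⟩
    v zero                                     ∎
  identity-∙ (suc i) v = begin
    0# * v zero + identity i ∙ (λ j → v (suc j))   ≈⟨ +-cong (zeroˡ _) (identity-∙ i λ j → v (suc j)) ⟩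
    0# + v (suc i)                                 ≈⟨ +-identityˡ _ ⟩
    v (suc i)                                      ∎

  sym-identity : (i j : Fin n) → identity i j ≈ identity j i
  sym-identity zero    zero    = refl
  sym-identity zero    (suc j) = refl
  sym-identity (suc i) zero    = refl
  sym-identity (suc i) (suc j) = sym-identity i j

  form-identity : (v : Vector Carrier n) → form identity v ≈ v ∙ v
  form-identity v = sum-cong-≋ λ i → *-congˡ (identity-∙ i v)

  form-linear : ∀ a b (A B : Matrix n n) v →
                form (λ i j → a * A i j + b * B i j) v ≈ a * form A v + b * form B v
  form-linear a b A B v = sum-linear a b λ i → trans
    (*-congˡ (sum-linear a b λ j → solve 5 (λ a b x y v → (a :* x :+ b :* y) :* v :=
        a :* (x :* v) :+ b :* (y :* v)) refl a b (A i j) (B i j) (v j)))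
    (solve 5 (λ a b x y v → v :* (a :* x :+ b :* y) := a :* (v :* x) :+ b :* (v :* y))
        refl a b (A i ∙ v) (B i ∙ v) (v i))

  -- A symmetric matrix whose form is at least x |v|² for some x > 0 has nonzero
  -- determinant.  Column operations with the pivot a = M₀₀ ≥ x clear the rest of
  -- the first row and leave the Schur complement C in the lower right corner, so
  -- det M = a det C.  Completing the square, the form of C at v is the form of M
  -- at (t, v) with t = - (b ∙ v) / a, hence C satisfies the same bound.
  boundedBelow⇒det≉0 : ∀ {x} (M : Matrix n n) → (∀ i j → M i j ≈ M j i) → 0# < x →
                       (∀ v → x * (v ∙ v) ≤ form M v) → ¬ (det M ≈ 0#)
  boundedBelow⇒det≉0 {zero}  M sym-M 0<x below = λ 1≈0 → <⇒≉ 0<1# (sym 1≈0)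
  boundedBelow⇒det≉0 {suc n} {x} M sym-M 0<x below det≈0 =
    *-≉0 (λ a≈0 → <⇒≉ 0<a (sym a≈0)) (boundedBelow⇒det≉0 C sym-C 0<x below-C) (trans (sym det-M≈) det≈0)
    where
    a = M zero zero
    b : Vector Carrier n
    b j = M zero (suc j)
    D : Matrix n n
    D i j = M (suc i) (suc j)

    form-M : ∀ t (v : Vector Carrier n) → form M (t ∷ v) ≈ a * t * t + t * (b ∙ v) + t * (b ∙ v) + form D v
    form-M t v = begin
      t * (a * t + b ∙ v) + sum (λ i → v i * (M (suc i) zero * t + D i ∙ v))
        ≈⟨ +-congˡ (sum-linear t 1# λ i → trans (*-congˡ (+-congʳ (*-congʳ (sym-M (suc i) zero))))
             (solve 4 (λ v b t d → v :* (b :* t :+ d) := t :* (b :* v) :+ con (+ 1) :* (v :* d))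
                 refl (v i) (b i) t (D i ∙ v))) ⟩
      t * (a * t + b ∙ v) + (t * (b ∙ v) + 1# * form D v)
        ≈⟨ solve 4 (λ t a β q → t :* (a :* t :+ β) :+ (t :* β :+ con (+ 1) :* q) :=
            a :* t :* t :+ t :* β :+ t :* β :+ q) refl t a (b ∙ v) (form D v) ⟩
      a * t * t + t * (b ∙ v) + t * (b ∙ v) + form D v ∎

    0s : Vector Carrier n
    0s _ = 0#

    0<a : 0# < a
    0<a = <-≤-trans 0<x (≤-resp
      (trans (*-congˡ (+-congˡ (sum-zero {f = λ i → 0s i * 0s i} λ i → zeroˡ 0#)))
          (solve 1 (λ x → x :* (con (+ 1) :* con (+ 1) :+ con (+ 0)) := x) refl x))
      (trans (form-M 1# 0s) (trans (+-cong (+-cong (+-congˡ (*-congˡ b∙0≈0)) (*-congˡ b∙0≈0))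
          (sum-zero {f = λ i → 0s i * (D i ∙ 0s)} λ i → zeroˡ (D i ∙ 0s)))
        (solve 1 (λ a → a :* con (+ 1) :* con (+ 1) :+ con (+ 1) :* con (+ 0) :+ con (+ 1) :* con (+ 0)
            :+ con (+ 0) := a) refl a)))
      (below (1# ∷ 0s)))
      where
      b∙0≈0 : b ∙ 0s ≈ 0#
      b∙0≈0 = sum-zero λ i → zeroʳ (b i)

    ι = proj₁ (inverse (inj₂ 0<a))
    a*ι≈1 : a * ι ≈ 1#
    a*ι≈1 = proj₂ (inverse (inj₂ 0<a))

    C : Matrix n n
    C i j = D i j + - (ι * b j) * M (suc i) zero

    sym-C : ∀ i j → C i j ≈ C j i
    sym-C i j = +-cong (sym-M (suc i) (suc j)) (trans (*-congˡ (sym-M (suc i) zero))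
      (trans (solve 3 (λ ι b c → :- (ι :* b) :* c := :- (ι :* c) :* b) refl ι (b j) (b i))
          (*-congˡ (sym-M zero (suc j)))))

    det-M≈ : det M ≈ a * det C
    det-M≈ = begin
      det M                         ≈⟨ det-cong {A = M} {u ∣ B} (λ { i zero → refl ; i (suc j) → refl }) ⟩
      det (u ∣ B)                   ≈⟨ det-addColumns u B (λ j → - (ι * b j)) ⟨
      det (u ∣ B′)                  ≈⟨ det-firstRow (u ∣ B′) first≈0 ⟩
      a * det C                     ∎
      where
      u = λ i → M i zero
      B : Matrix (suc n) n
      B i j = M i (suc j)
      B′ : Matrix (suc n) n
      B′ i j = B i j + - (ι * b j) * u i
      first≈0 : ∀ j → B′ zero j ≈ 0#
      first≈0 j = begin
        b j + - (ι * b j) * a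
          ≈⟨ solve 3 (λ a b ι → b :+ :- (ι :* b) :* a := b :- b :* (a :* ι)) refl a (b j) ι ⟩
        b j - b j * (a * ι)         ≈⟨ +-congˡ (-‿cong (trans (*-congˡ a*ι≈1) (*-identityʳ _))) ⟩
        b j - b j                   ≈⟨ -‿inverseʳ _ ⟩
        0#                          ∎

    form-C : ∀ v → form C v ≈ form M (- (ι * (b ∙ v)) ∷ v)
    form-C v = begin
      form C v
        ≈⟨ sum-linear 1# (- (ι * β)) (λ i → trans (*-congˡ (row i))
             (solve 5 (λ v d ι m β → v :* (con (+ 1) :* d :+ :- (ι :* m) :* β) :=
                 con (+ 1) :* (v :* d) :+ :- (ι :* β) :* (m :* v)) refl (v i) (D i ∙ v) ι (b i) β)) ⟩
      1# * form D v + - (ι * β) * β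
        ≈⟨ solve 3 (λ q ι β → con (+ 1) :* q :+ :- (ι :* β) :* β :=
             con (+ 1) :* (ι :* β :* β) :+ :- (ι :* β) :* β :+ :- (ι :* β) :* β :+ q) refl (form D v) ι β ⟩
      1# * (ι * β * β) + - (ι * β) * β + - (ι * β) * β + form D v
        ≈⟨ +-congʳ (+-congʳ (+-congʳ (trans (*-congʳ (sym a*ι≈1))
             (solve 3 (λ a ι β → a :* ι :* (ι :* β :* β) := a :* (:- (ι :* β)) :* (:- (ι :* β))) refl a ι β))))
                 ⟩
      a * t * t + t * β + t * β + form D v
        ≈⟨ form-M t v ⟨
      form M (t ∷ v) ∎
      where
      β = b ∙ v
      t = - (ι * β)
      row : ∀ i → C i ∙ v ≈ 1# * (D i ∙ v) + - (ι * b i) * β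
      row i = sum-linear 1# (- (ι * b i)) λ j → trans (*-congʳ (+-congˡ (*-congˡ (sym-M (suc i) zero))))
        (solve 5 (λ d ι m b v → (d :+ :- (ι :* b) :* m) :* v :=
            con (+ 1) :* (d :* v) :+ :- (ι :* m) :* (b :* v)) refl (D i j) ι (b i) (b j) (v j))

    below-C : ∀ v → x * (v ∙ v) ≤ form C v
    below-C v = ≤-trans (0≤y-x⇒x≤y (≤-resp refl (solve 3 (λ x t q → x :* (t :* t) :=
        x :* (t :* t :+ q) :- x :* q) refl x t (v ∙ v)) (0≤* (<⇒≤ 0<x) (0≤sq t))))
      (≤-resp refl (sym (form-C v)) (below (t ∷ v)))
      where
      t = - (ι * (b ∙ v))

-- The spectrum of 2δJ - 2Y
module Spectrum {c ℓ₁ ℓ₂} (ℝ : RealField c ℓ₁ ℓ₂) where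

  open RealAlgebra ℝ
  open Order ℝ
  open Determinant ℝ
  open Polynomial ℝ
  open QuadraticForm ℝ
  open CommutativeMonoidSum *-commutativeMonoid using () renaming (sum-remove to product-remove)

  private variable
    n : ℕ

  product-≉0 : {f : Vector Carrier n} → (∀ i → ¬ (f i ≈ 0#)) → ¬ (product f ≈ 0#)
  product-≉0 {zero}  f≉0 1≈0 = <⇒≉ 0<1# (sym 1≈0)
  product-≉0 {suc n} f≉0 = *-≉0 (f≉0 zero) (product-≉0 λ i → f≉0 (suc i))

  product-≈0 : (f : Vector Carrier n) (i : Fin n) → f i ≈ 0# → product f ≈ 0#
  product-≈0 f zero    f₀≈0 = trans (*-congʳ f₀≈0) (zeroˡ _)
  product-≈0 f (suc i) fᵢ≈0 = trans (*-congˡ (product-≈0 (λ j → f (suc j)) i fᵢ≈0)) (zeroʳ _)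

  -- The all-ones vector.
  1s : Vector Carrier n
  1s _ = 1#

  sum-identity : (i : Fin n) → sum (identity i) ≈ 1#
  sum-identity i = trans (sum-cong-≋ λ j → sym (*-identityʳ (identity i j))) (identity-∙ i 1s)

  det-scaleColumn : ∀ a (u : Vector Carrier (suc n)) (B : Matrix (suc n) n) →
                    det ((λ i → a * u i) ∣ B) ≈ a * det (u ∣ B)
  det-scaleColumn a u B = begin
    det ((λ i → a * u i) ∣ B)
      ≈⟨ det-cong {A = (λ i → a * u i) ∣ B} {(λ i → a * u i + 0# * u i) ∣ B}
           (∣-cong (λ i → solve 2 (λ a u → a :* u := a :* u :+ con (+ 0) :* u) refl a (u i)) λ i j → refl) ⟩
    det ((λ i → a * u i + 0# * u i) ∣ B)     ≈⟨ det-linear a 0# u u B ⟩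
    a * det (u ∣ B) + 0# * det (u ∣ B)
      ≈⟨ solve 2 (λ a d → a :* d :+ con (+ 0) :* d := a :* d) refl a (det (u ∣ B)) ⟩
    a * det (u ∣ B)                          ∎

  -- Here J is the all-ones matrix and R = 2δJ - 2Y, where Y is symmetric and
  -- positive semidefinite with zero row sums and constant diagonal δ.
  module _ {n} (Y R : Matrix (suc n) (suc n)) (δ : Carrier)
    (sym-Y : ∀ i j → Y i j ≈ Y j i) (0≤Y : ∀ v → 0# ≤ form Y v) (sum-Y≈0 : ∀ i → sum (Y i) ≈ 0#)
    (Yᵢᵢ≈δ : ∀ i → Y i i ≈ δ) (R≈ : ∀ i j → R i j ≈ (δ + δ) - (Y i j + Y i j)) where

    -- The common row sum of R.
    K : Carrier
    K = (δ + δ) * fromℕ (suc n)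

    xI+2Y : Carrier → Matrix (suc n) (suc n)
    xI+2Y x i j = x * identity i j + (1# + 1#) * Y i j

    -- In both  xI - R  and  xI + 2Y  the row sums are constant, x - K and x, and
    -- the two matrices differ by a multiple of the all-ones matrix.  Replacing the
    -- first column by the row sums thus shows that their determinants are
    -- (x - K) q(x)  and  x q(x)  with the same q.
    q : Carrier → Carrier
    q x = det (1s ∣ λ i j → xI+2Y x i (suc j))

    q-polynomial : IsPolynomial q
    q-polynomial = det-polynomial {A = λ i j x → (1s ∣ λ i j → xI+2Y x i (suc j)) i j} λ
      { i zero → constant 1#
      ; i (suc j) → indeterminate ⊠ constant (identity i (suc j)) ⊞ constant ((1# + 1#) * Y i (suc j)) }

    sum-xI+2Y : ∀ x i → sum (xI+2Y x i) ≈ x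
    sum-xI+2Y x i = begin
      sum (xI+2Y x i)
        ≈⟨ sum-linear x (1# + 1#) {xI+2Y x i} {identity i} {Y i} (λ j → refl) ⟩
      x * sum (identity i) + (1# + 1#) * sum (Y i)
        ≈⟨ +-cong (*-congˡ (sum-identity i)) (*-congˡ (sum-Y≈0 i)) ⟩
      x * 1# + (1# + 1#) * 0#
        ≈⟨ solve 1 (λ x → x :* con (+ 1) :+ (con (+ 1) :+ con (+ 1)) :* con (+ 0) := x) refl x ⟩
      x                                               ∎

    det-xI+2Y : ∀ x → det (xI+2Y x) ≈ x * q x
    det-xI+2Y x = begin
      det (xI+2Y x)                                             ≈⟨ det-rowSums (xI+2Y x) ⟩
      det ((λ i → sum (xI+2Y x i)) ∣ λ i j → xI+2Y x i (suc j))
        ≈⟨ det-cong {A = (λ i → sum (xI+2Y x i)) ∣ λ i j → xI+2Y x i (suc j)}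
            {(λ i → x * 1#) ∣ λ i j → xI+2Y x i (suc j)}
           (∣-cong (λ i → trans (sum-xI+2Y x i) (sym (*-identityʳ x))) λ i j → refl) ⟩
      det ((λ i → x * 1#) ∣ λ i j → xI+2Y x i (suc j))
        ≈⟨ det-scaleColumn x 1s (λ i j → xI+2Y x i (suc j)) ⟩
      x * q x                                               ∎

    charPoly-R : ∀ x → charPoly R x ≈ (x - K) * q x
    charPoly-R x = begin
      det C                                        ≈⟨ det-rowSums C ⟩
      det ((λ i → sum (C i)) ∣ λ i j → C i (suc j))
        ≈⟨ det-cong {A = (λ i → sum (C i)) ∣ λ i j → C i (suc j)} {(λ i → (x - K) * 1#) ∣ B}
            (∣-cong (λ i → trans (sum-C i) (sym (*-identityʳ _))) λ i j → C≈ i (suc j)) ⟩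
      det ((λ i → (x - K) * 1#) ∣ B)               ≈⟨ det-scaleColumn (x - K) 1s B ⟩
      (x - K) * det (1s ∣ B)
        ≈⟨ *-congˡ (det-addColumns 1s (λ i j → xI+2Y x i (suc j)) λ _ → - (δ + δ)) ⟩
      (x - K) * q x                                ∎
      where
      C : Matrix (suc n) (suc n)
      C i j = x * identity i j - R i j
      B : Matrix (suc n) n
      B i j = xI+2Y x i (suc j) + - (δ + δ) * 1#
      C≈ : ∀ i j → C i j ≈ xI+2Y x i j + - (δ + δ) * 1#
      C≈ i j = trans (+-congˡ (-‿cong (R≈ i j)))
        (solve 4 (λ x e d y → x :* e :- (d :+ d :- (y :+ y)) :=
            x :* e :+ (con (+ 1) :+ con (+ 1)) :* y :+ :- (d :+ d) :* con (+ 1))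
            refl x (identity i j) δ (Y i j))
      sum-C : ∀ i → sum (C i) ≈ x - K
      sum-C i = begin
        sum (C i)
          ≈⟨ sum-linear 1# (- (δ + δ)) {g = xI+2Y x i} {h = 1s}
              (λ j → trans (C≈ i j) (+-congʳ (sym (*-identityˡ _)))) ⟩
        1# * sum (xI+2Y x i) + - (δ + δ) * sum (1s {suc n})
          ≈⟨ +-cong (trans (*-identityˡ _) (sum-xI+2Y x i)) (*-congˡ (sum-replicate (suc n))) ⟩
        x + - (δ + δ) * fromℕ (suc n)
          ≈⟨ solve 3 (λ x d m → x :+ :- (d :+ d) :* m := x :- (d :+ d) :* m) refl x δ (fromℕ (suc n)) ⟩
        x - K                                           ∎

    q≉0 : ∀ {x} → 0# < x → ¬ (q x ≈ 0#)
    q≉0 {x} 0<x qx≈0 = boundedBelow⇒det≉0 (xI+2Y x) sym-xI+2Y 0<x below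
        (trans (det-xI+2Y x) (trans (*-congˡ qx≈0) (zeroʳ x)))
      where
      sym-xI+2Y : ∀ i j → xI+2Y x i j ≈ xI+2Y x j i
      sym-xI+2Y i j = +-cong (*-congˡ (sym-identity i j)) (*-congˡ (sym-Y i j))
      below : ∀ v → x * (v ∙ v) ≤ form (xI+2Y x) v
      below v = 0≤y-x⇒x≤y (≤-resp refl (begin
        form Y v + form Y v
          ≈⟨ solve 2 (λ a q → q :+ q := a :+ (con (+ 1) :+ con (+ 1)) :* q :- a) refl (x * (v ∙ v)) (form Y v) ⟩
        x * (v ∙ v) + (1# + 1#) * form Y v - x * (v ∙ v)
          ≈⟨ +-congʳ (+-congʳ (*-congˡ (form-identity v))) ⟨
        x * form identity v + (1# + 1#) * form Y v - x * (v ∙ v)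
          ≈⟨ +-congʳ (form-linear x (1# + 1#) identity Y v) ⟨
        form (xI+2Y x) v - x * (v ∙ v) ∎) (0≤+ (0≤Y v) (0≤Y v)))

    trace-R : sum (λ i → R i i) ≈ 0#
    trace-R = sum-zero λ i → begin
      R i i                           ≈⟨ R≈ i i ⟩
      δ + δ - (Y i i + Y i i)         ≈⟨ +-congˡ (-‿cong (+-cong (Yᵢᵢ≈δ i) (Yᵢᵢ≈δ i))) ⟩
      δ + δ - (δ + δ)                 ≈⟨ -‿inverseʳ _ ⟩
      0#                              ∎

    module _ (λs : Vector Carrier (suc n)) (spectrum : HasSpectrum R λs) where

      -- Let λ₀ = K be one of the roots and let g be the product of the other factors
      -- x - μⱼ.  Then g = q away from K, and at K by continuity, so g has no positive
      -- root: every μⱼ is at most 0.  Since the trace is 0, the μⱼ sum to -K.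
      energy-at : ∀ i₀ → K - λs i₀ ≈ 0# → sum (λ i → abs (λs i)) ≈ K + K
      energy-at i₀ K-λ₀≈0 = begin
        sum (λ i → abs (λs i))                    ≈⟨ sum-remove {i = i₀} (λ i → abs (λs i)) ⟩
        abs λ₀ + sum (λ j → abs (μs j))
          ≈⟨ +-cong (abs-nonneg 0≤λ₀) (trans (sum-cong-≋ λ j → abs-nonpos (μ≤0 j)) (sum-neg μs)) ⟩
        λ₀ - sum μs
          ≈⟨ solve 2 (λ a b → a :- b := a :+ a :- (a :+ b)) refl λ₀ (sum μs) ⟩
        λ₀ + λ₀ - (λ₀ + sum μs)                   ≈⟨ +-cong (+-cong λ₀≈K λ₀≈K) (-‿cong λ₀+Σμ≈0) ⟩
        K + K - 0#                                ≈⟨ solve 1 (λ k → k :- con (+ 0) := k) refl (K + K) ⟩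
        K + K                                     ∎
        where
        λ₀ = λs i₀
        μs = removeAt λs i₀
        λ₀≈K : λ₀ ≈ K
        λ₀≈K = trans (solve 2 (λ l k → l := k :- (k :- l)) refl λ₀ K)
            (trans (+-congˡ (-‿cong K-λ₀≈0)) (solve 1 (λ k → k :- con (+ 0) := k) refl K))
        g : Carrier → Carrier
        g x = product λ j → x + - 1# * μs j
        g-polynomial : IsPolynomial g
        g-polynomial = product-polynomial λ j → indeterminate ⊞ constant (- 1#) ⊠ constant (μs j)
        factor : ∀ x → (x - K) * g x ≈ (x - K) * q x
        factor x = begin
          (x - K) * g x
            ≈⟨ *-cong (+-congˡ (-‿cong (sym λ₀≈K)))
                (product-cong λ j → +-congˡ (solve 1 (λ m → con -[1+ 0 ] :* m := :- m) refl (μs j))) ⟩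
          (x - λ₀) * product (λ j → x - μs j)         ≈⟨ product-remove {i = i₀} (λ i → x - λs i) ⟨
          product (λ i → x - λs i)                    ≈⟨ spectrum x ⟨
          charPoly R x                                ≈⟨ charPoly-R x ⟩
          (x - K) * q x                               ∎
        g-q≈0 : g K + - 1# * q K ≈ 0#
        g-q≈0 = vanishing-at (g-polynomial ⊞ constant (- 1#) ⊠ q-polynomial) K λ x K<x →
          trans (+-congʳ (*-cancelˡ (inj₂ (x<y⇒0<y-x K<x)) (factor x)))
            (solve 1 (λ q → q :+ con -[1+ 0 ] :* q := con (+ 0)) refl (q x))
        g-root : ∀ {x} j → x ≈ μs j → g x ≈ 0#
        g-root {x} j x≈μ = product-≈0 (λ j → x + - 1# * μs j) j
          (trans (+-congʳ x≈μ) (solve 1 (λ m → m :+ con -[1+ 0 ] :* m := con (+ 0)) refl (μs j)))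
        μ≤0 : ∀ j → μs j ≤ 0#
        μ≤0 j 0<μ = *-≉0 μ-K≉0 (q≉0 0<μ) (trans (sym (factor (μs j)))
            (trans (*-congˡ (g-root j refl)) (zeroʳ _)))
          where
          μ-K≉0 : ¬ (μs j - K ≈ 0#)
          μ-K≉0 μ-K≈0 = q≉0 0<μ (begin
            q (μs j)             ≈⟨ poly-cong q-polynomial (sym K≈μ) ⟩
            q K                  ≈⟨ solve 2 (λ g q → q := g :- (g :+ con -[1+ 0 ] :* q)) refl (g K) (q K) ⟩
            g K - (g K + - 1# * q K)   ≈⟨ +-cong (g-root j K≈μ) (-‿cong g-q≈0) ⟩
            0# - 0#              ≈⟨ -‿inverseʳ 0# ⟩
            0#                   ∎)
            where
            K≈μ : K ≈ μs j
            K≈μ = trans (solve 2 (λ m k → k := m :- (m :- k)) refl (μs j) K)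
                (trans (+-congˡ (-‿cong μ-K≈0)) (solve 1 (λ k → k :- con (+ 0) := k) refl (μs j)))
        λ₀+Σμ≈0 : λ₀ + sum μs ≈ 0#
        λ₀+Σμ≈0 = trans (sym (sum-remove {i = i₀} λs)) (trans (sum-spectrum≈trace R λs spectrum) trace-R)
        0≤λ₀ : 0# ≤ λ₀
        0≤λ₀ = ≤-resp refl (begin
          sum (λ j → - μs j)      ≈⟨ sum-neg μs ⟩
          - sum μs                ≈⟨ solve 2 (λ a b → :- b := a :- (a :+ b)) refl λ₀ (sum μs) ⟩
          λ₀ - (λ₀ + sum μs)      ≈⟨ +-congˡ (-‿cong λ₀+Σμ≈0) ⟩
          λ₀ - 0#                 ≈⟨ solve 1 (λ k → k :- con (+ 0) := k) refl λ₀ ⟩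
          λ₀                      ∎)
          (sum-nonneg (λ j → - μs j) λ j → neg-nonneg (μ≤0 j))

      -- Some root equals K, because K is a zero of the characteristic polynomial.
      energy : sum (λ i → abs (λs i)) ≈ K + K
      energy = ≈-stable λ energy≉ →
        product-≉0 (λ i K-λ≈0 → energy≉ (energy-at i K-λ≈0)) (begin
          product (λ i → K - λs i)    ≈⟨ spectrum K ⟨
          charPoly R K                ≈⟨ charPoly-R K ⟩
          (K - K) * q K               ≈⟨ *-congʳ (-‿inverseʳ K) ⟩
          0# * q K                    ≈⟨ zeroˡ _ ⟩
          0#                          ∎)

-- Moore-Penrose inverses and Laplacians
module PseudoInverse {c ℓ₁ ℓ₂} (ℝ : RealField c ℓ₁ ℓ₂) where

  open RealAlgebra ℝ
  open Order ℝ
  open Determinant ℝ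
  open QuadraticForm ℝ
  open IsMoorePenroseInverse
  open Graph

  private variable
    k l m n : ℕ

  ⊗-cong : {A A′ : Matrix l m} {B B′ : Matrix m n} → A ≋ A′ → B ≋ B′ → A ⊗ B ≋ A′ ⊗ B′
  ⊗-cong A≋A′ B≋B′ i j = sum-cong-≋ λ k → *-cong (A≋A′ i k) (B≋B′ k j)

  ⊗-congˡ : (A : Matrix l m) {B B′ : Matrix m n} → B ≋ B′ → A ⊗ B ≋ A ⊗ B′
  ⊗-congˡ A B≋B′ = ⊗-cong {A = A} (λ i k → refl) B≋B′

  ⊗-congʳ : {A A′ : Matrix l m} (B : Matrix m n) → A ≋ A′ → A ⊗ B ≋ A′ ⊗ B
  ⊗-congʳ B A≋A′ = ⊗-cong {B = B} A≋A′ (λ k j → refl)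

  ⊗-∙ : (A : Matrix l m) (B : Matrix m n) (v : Vector Carrier n) → ∀ i → (A ⊗ B) i ∙ v ≈ A i ∙ (λ k → B k ∙ v)
  ⊗-∙ A B v i = begin
    sum (λ j → sum (λ k → A i k * B k j) * v j)
      ≈⟨ sum-cong-≋ (λ j → *-distribʳ-sum (v j) λ k → A i k * B k j) ⟩
    sum (λ j → sum λ k → A i k * B k j * v j)       ≈⟨ ∑-comm (λ j k → A i k * B k j * v j) ⟩
    sum (λ k → sum λ j → A i k * B k j * v j)
      ≈⟨ sum-cong-≋ (λ k → trans (sum-cong-≋ λ j → *-assoc (A i k) (B k j) (v j))
          (sym (*-distribˡ-sum (A i k) λ j → B k j * v j))) ⟩
    sum (λ k → A i k * (B k ∙ v))                   ∎

  ⊗-assoc : (A : Matrix k l) (B : Matrix l m) (C : Matrix m n) → (A ⊗ B) ⊗ C ≋ A ⊗ (B ⊗ C)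
  ⊗-assoc A B C i j = ⊗-∙ A B (λ k → C k j) i

  ⊗-ᵀ : (A : Matrix l m) (B : Matrix m n) → (A ⊗ B) ᵀ ≋ B ᵀ ⊗ A ᵀ
  ⊗-ᵀ A B i j = sum-cong-≋ λ k → *-comm (A j k) (B k i)

  identity-⊗ : (A : Matrix m n) → identity ⊗ A ≋ A
  identity-⊗ A i j = identity-∙ i λ k → A k j

  scale-⊗ : ∀ a b (A : Matrix l m) (B : Matrix m n) →
            (λ i j → a * A i j) ⊗ (λ i j → b * B i j) ≋ λ i j → a * b * (A ⊗ B) i j
  scale-⊗ a b A B i j = trans
    (sum-cong-≋ λ k → solve 4 (λ a b x y → a :* x :* (b :* y) := a :* b :* (x :* y)) refl a b (A i k) (B k j))
    (sym (*-distribˡ-sum (a * b) λ k → A i k * B k j))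

  MP-cong : {A B : Matrix m n} {X : Matrix n m} → A ≋ B → IsMoorePenroseInverse A X →
            IsMoorePenroseInverse B X
  MP-cong {A = A} {B} {X} A≋B mp = record
    { AA†A≋A = λ i j → trans (⊗-cong (⊗-cong B≋A X≋X) B≋A i j) (trans (AA†A≋A mp i j) (A≋B i j))
    ; A†AA†≋A† = λ i j → trans (⊗-cong (⊗-cong X≋X B≋A) X≋X i j) (A†AA†≋A† mp i j)
    ; AA†-selfAdj = λ i j → trans (⊗-cong B≋A X≋X j i) (trans (AA†-selfAdj mp i j) (⊗-cong A≋B X≋X i j))
    ; A†A-selfAdj = λ i j → trans (⊗-cong X≋X B≋A j i) (trans (A†A-selfAdj mp i j) (⊗-cong X≋X A≋B i j))
    }
    where
    X≋X : X ≋ X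
    X≋X i j = refl
    B≋A : B ≋ A
    B≋A i j = sym (A≋B i j)

  MP-ᵀ : {A : Matrix m n} {X : Matrix n m} → IsMoorePenroseInverse A X →
          IsMoorePenroseInverse (A ᵀ) (X ᵀ)
  MP-ᵀ {A = A} {X} mp = record
    { AA†A≋A = λ i j → begin
        (A ᵀ ⊗ X ᵀ ⊗ A ᵀ) i j      ≈⟨ ⊗-congʳ (A ᵀ) (λ i j → sym (⊗-ᵀ X A i j)) i j ⟩
        ((X ⊗ A) ᵀ ⊗ A ᵀ) i j      ≈⟨ ⊗-ᵀ A (X ⊗ A) i j ⟨
        (A ⊗ (X ⊗ A)) j i          ≈⟨ ⊗-assoc A X A j i ⟨
        (A ⊗ X ⊗ A) j i            ≈⟨ AA†A≋A mp j i ⟩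
        A j i                      ∎
    ; A†AA†≋A† = λ i j → begin
        (X ᵀ ⊗ A ᵀ ⊗ X ᵀ) i j      ≈⟨ ⊗-congʳ (X ᵀ) (λ i j → sym (⊗-ᵀ A X i j)) i j ⟩
        ((A ⊗ X) ᵀ ⊗ X ᵀ) i j      ≈⟨ ⊗-ᵀ X (A ⊗ X) i j ⟨
        (X ⊗ (A ⊗ X)) j i          ≈⟨ ⊗-assoc X A X j i ⟨
        (X ⊗ A ⊗ X) j i            ≈⟨ A†AA†≋A† mp j i ⟩
        X j i                      ∎
    ; AA†-selfAdj = λ i j → trans (sym (⊗-ᵀ X A j i)) (trans (A†A-selfAdj mp j i) (⊗-ᵀ X A i j))
    ; A†A-selfAdj = λ i j → trans (sym (⊗-ᵀ A X j i)) (trans (AA†-selfAdj mp j i) (⊗-ᵀ A X i j))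
    }

  -- AX = (AYA)X = (AY)(AX) is a product of self-adjoint matrices, hence the
  -- transpose of (AX)(AY) = AY, and AY is self-adjoint.
  MP-projection : {A : Matrix m n} {X Y : Matrix n m} → IsMoorePenroseInverse A X → IsMoorePenroseInverse A Y →
                  A ⊗ X ≋ A ⊗ Y
  MP-projection {A = A} {X} {Y} mpX mpY i j = begin
    (A ⊗ X) i j                    ≈⟨ ⊗-congʳ X (λ i j → sym (AA†A≋A mpY i j)) i j ⟩
    (A ⊗ Y ⊗ A ⊗ X) i j            ≈⟨ ⊗-assoc (A ⊗ Y) A X i j ⟩
    ((A ⊗ Y) ⊗ (A ⊗ X)) i j
      ≈⟨ ⊗-cong (λ i j → sym (AA†-selfAdj mpY i j)) (λ i j → sym (AA†-selfAdj mpX i j)) i j ⟩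
    ((A ⊗ Y) ᵀ ⊗ (A ⊗ X) ᵀ) i j    ≈⟨ ⊗-ᵀ (A ⊗ X) (A ⊗ Y) i j ⟨
    ((A ⊗ X) ⊗ (A ⊗ Y)) j i        ≈⟨ ⊗-assoc (A ⊗ X) A Y j i ⟨
    (A ⊗ X ⊗ A ⊗ Y) j i            ≈⟨ ⊗-congʳ Y (AA†A≋A mpX) j i ⟩
    (A ⊗ Y) j i                    ≈⟨ AA†-selfAdj mpY i j ⟩
    (A ⊗ Y) i j                    ∎

  MP-unique : {A : Matrix m n} {X Y : Matrix n m} → IsMoorePenroseInverse A X → IsMoorePenroseInverse A Y →
              X ≋ Y
  MP-unique {A = A} {X} {Y} mpX mpY i j = begin
    X i j                ≈⟨ A†AA†≋A† mpX i j ⟨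
    (X ⊗ A ⊗ X) i j      ≈⟨ ⊗-congʳ X XA≋YA i j ⟩
    (Y ⊗ A ⊗ X) i j      ≈⟨ ⊗-assoc Y A X i j ⟩
    (Y ⊗ (A ⊗ X)) i j    ≈⟨ ⊗-congˡ Y (MP-projection mpX mpY) i j ⟩
    (Y ⊗ (A ⊗ Y)) i j    ≈⟨ ⊗-assoc Y A Y i j ⟨
    (Y ⊗ A ⊗ Y) i j      ≈⟨ A†AA†≋A† mpY i j ⟩
    Y i j                ∎
    where
    XA≋YA : X ⊗ A ≋ Y ⊗ A
    XA≋YA i j = trans (⊗-ᵀ X A j i) (trans (MP-projection (MP-ᵀ mpX) (MP-ᵀ mpY) j i) (sym (⊗-ᵀ Y A j i)))

  MP-scale : ∀ {a b} {A : Matrix m n} {X : Matrix n m} → a * b ≈ 1# → IsMoorePenroseInverse A X →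
             IsMoorePenroseInverse (λ i j → a * A i j) (λ i j → b * X i j)
  MP-scale {a = a} {b} {A} {X} ab≈1 mp = record
    { AA†A≋A = λ i j → begin
        (aA ⊗ bX ⊗ aA) i j                           ≈⟨ ⊗-congʳ aA aAbX i j ⟩
        ((A ⊗ X) ⊗ aA) i j
          ≈⟨ ⊗-congʳ {A = A ⊗ X} aA (λ i j → sym (*-identityˡ _)) i j ⟩
        ((λ i j → 1# * (A ⊗ X) i j) ⊗ aA) i j        ≈⟨ scale-⊗ 1# a (A ⊗ X) A i j ⟩
        1# * a * (A ⊗ X ⊗ A) i j                     ≈⟨ *-cong (*-identityˡ a) (AA†A≋A mp i j) ⟩
        a * A i j                                    ∎
    ; A†AA†≋A† = λ i j → begin
        (bX ⊗ aA ⊗ bX) i j                           ≈⟨ ⊗-congʳ bX bXaA i j ⟩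
        ((X ⊗ A) ⊗ bX) i j
          ≈⟨ ⊗-congʳ {A = X ⊗ A} bX (λ i j → sym (*-identityˡ _)) i j ⟩
        ((λ i j → 1# * (X ⊗ A) i j) ⊗ bX) i j        ≈⟨ scale-⊗ 1# b (X ⊗ A) X i j ⟩
        1# * b * (X ⊗ A ⊗ X) i j                     ≈⟨ *-cong (*-identityˡ b) (A†AA†≋A† mp i j) ⟩
        b * X i j                                    ∎
    ; AA†-selfAdj = λ i j → trans (aAbX j i) (trans (AA†-selfAdj mp i j) (sym (aAbX i j)))
    ; A†A-selfAdj = λ i j → trans (bXaA j i) (trans (A†A-selfAdj mp i j) (sym (bXaA i j)))
    }
    where
    aA = λ i j → a * A i j
    bX = λ i j → b * X i j
    aAbX : aA ⊗ bX ≋ A ⊗ X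
    aAbX i j = trans (scale-⊗ a b A X i j) (trans (*-congʳ ab≈1) (*-identityˡ _))
    bXaA : bX ⊗ aA ≋ X ⊗ A
    bXaA i j = trans (scale-⊗ b a X A i j) (trans (*-congʳ (trans (*-comm b a) ab≈1)) (*-identityˡ _))

  MP-identity : IsMoorePenroseInverse (identity {n}) identity
  MP-identity = record
    { AA†A≋A = λ i j → trans (⊗-congʳ identity (identity-⊗ identity) i j) (identity-⊗ identity i j)
    ; A†AA†≋A† = λ i j → trans (⊗-congʳ identity (identity-⊗ identity) i j) (identity-⊗ identity i j)
    ; AA†-selfAdj = selfAdj
    ; A†A-selfAdj = selfAdj
    }
    where
    selfAdj : (identity ⊗ identity) ᵀ ≋ identity ⊗ identity
    selfAdj i j = trans (identity-⊗ identity j i) (trans (sym-identity j i) (sym (identity-⊗ identity i j)))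

  fromℕ-degree : (G : Graph n) (i : Fin n) → fromℕ (degree G i) ≈ sum (adjacencyMatrix G i)
  fromℕ-degree G i = count (adj G i)
    where
    count : ∀ {n} (f : Fin n → Bool) → fromℕ ∣ Vec.tabulate f ∣ ≈ sum λ j → if f j then 1# else 0#
    count {zero}  f = refl
    count {suc n} f with f zero
    ... | true  = +-congˡ (count λ j → f (suc j))
    ... | false = trans (count λ j → f (suc j)) (sym (+-identityˡ _))

  adjacency-sym : (G : Graph n) → ∀ i j → adjacencyMatrix G i j ≈ adjacencyMatrix G j i
  adjacency-sym G i j = reflexive (≡.cong (λ b → if b then 1# else 0#) (adj-sym G i j))

  adjacency-nonneg : (G : Graph n) → ∀ i j → 0# ≤ adjacencyMatrix G i j
  adjacency-nonneg G i j with adj G i j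
  ... | true  = <⇒≤ 0<1#
  ... | false = ≤-reflexive refl

  *-identity-swap : (f : Vector Carrier n) → ∀ i j → f i * identity i j ≈ f j * identity j i
  *-identity-swap f zero    zero    = refl
  *-identity-swap f zero    (suc j) = trans (zeroʳ _) (sym (zeroʳ _))
  *-identity-swap f (suc i) zero    = trans (zeroʳ _) (sym (zeroʳ _))
  *-identity-swap f (suc i) (suc j) = *-identity-swap (λ i → f (suc i)) i j

  module _ (G : Graph n) where
    private
      L A : Matrix n n
      L = laplacian G
      A = adjacencyMatrix G

    laplacian-sym : ∀ i j → L i j ≈ L j i
    laplacian-sym i j = +-cong (*-identity-swap (λ i → fromℕ (degree G i)) i j) (-‿cong (adjacency-sym G i j))

    laplacian-∙ : ∀ i v → L i ∙ v ≈ sum λ j → A i j * (v i - v j)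
    laplacian-∙ i v = begin
      L i ∙ v
        ≈⟨ sum-linear d (- 1#) (λ j → solve 4 (λ d e a v → (d :* e :- a) :* v :=
            d :* (e :* v) :+ con -[1+ 0 ] :* (a :* v)) refl d (identity i j) (A i j) (v j)) ⟩
      d * (identity i ∙ v) + - 1# * (A i ∙ v)
        ≈⟨ +-congʳ (trans (*-cong (fromℕ-degree G i) (identity-∙ i v)) (*-comm _ _)) ⟩
      v i * sum (A i) + - 1# * (A i ∙ v)
        ≈⟨ sum-linear (v i) (- 1#) {λ j → A i j * (v i - v j)} {A i} (λ j → solve 3 (λ a v w → a :* (v :- w) :=
            v :* a :+ con -[1+ 0 ] :* (a :* w)) refl (A i j) (v i) (v j)) ⟨
      sum (λ j → A i j * (v i - v j)) ∎
      where
      d = fromℕ (degree G i)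

    laplacian-rowSum : ∀ i → sum (L i) ≈ 0#
    laplacian-rowSum i = begin
      sum (L i)                                    ≈⟨ sum-cong-≋ (λ j → *-identityʳ (L i j)) ⟨
      L i ∙ (λ _ → 1#)                             ≈⟨ laplacian-∙ i (λ _ → 1#) ⟩
      sum (λ j → A i j * (1# - 1#))
        ≈⟨ sum-zero (λ j → trans (*-congˡ (-‿inverseʳ 1#)) (zeroʳ (A i j))) ⟩
      0#                                           ∎

    -- Twice the form of L at v is the sum of aᵢⱼ (vᵢ - vⱼ)² over all i and j.
    laplacian-nonneg : ∀ v → 0# ≤ form L v
    laplacian-nonneg v = 0≤x+x⇒0≤x (≤-resp refl (sym twice)
      (sum-nonneg (λ i → sum (S i)) λ i → sum-nonneg (S i) λ j → 0≤* (adjacency-nonneg G i j)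
          (0≤sq (v i - v j))))
      where
      F S : Fin n → Fin n → Carrier
      F i j = v i * (A i j * (v i - v j))
      S i j = A i j * ((v i - v j) * (v i - v j))
      form≈ : form L v ≈ sum λ i → sum (F i)
      form≈ = sum-cong-≋ λ i → trans (*-congˡ (laplacian-∙ i v))
          (*-distribˡ-sum (v i) λ j → A i j * (v i - v j))
      twice : form L v + form L v ≈ sum λ i → sum (S i)
      twice = begin
        form L v + form L v                                       ≈⟨ +-cong form≈ (trans form≈ (∑-comm F)) ⟩
        sum (λ i → sum (F i)) + sum (λ i → sum λ j → F j i)
          ≈⟨ ∑-distrib-+ (λ i → sum (F i)) (λ i → sum λ j → F j i) ⟨
        sum (λ i → sum (F i) + sum (λ j → F j i))
          ≈⟨ sum-cong-≋ (λ i → trans (sym (∑-distrib-+ (F i) λ j → F j i)) (sum-cong-≋ (F+F i))) ⟩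
        sum (λ i → sum (S i))                                     ∎
        where
        F+F : ∀ i j → F i j + F j i ≈ S i j
        F+F i j = trans (+-congˡ (*-congˡ (*-congʳ (adjacency-sym G j i))))
          (solve 3 (λ a v w → v :* (a :* (v :- w)) :+ w :* (a :* (w :- v)) := a :* ((v :- w) :* (v :- w)))
              refl (A i j) (v i) (v j))

    module _ {X : Matrix n n} (mp : IsMoorePenroseInverse L X) where

      pinv-sym : ∀ i j → X i j ≈ X j i
      pinv-sym i j = MP-unique mp (MP-cong (λ i j → laplacian-sym j i) (MP-ᵀ mp)) i j

      -- X = X(LX), and the rows of LX = (LX)ᵀ = XᵀLᵀ sum to zero as those of Lᵀ do.
      pinv-rowSum : ∀ i → sum (X i) ≈ 0#
      pinv-rowSum i = begin
        sum (X i)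
          ≈⟨ sum-cong-≋ (λ j → trans (*-identityʳ _) (sym-XLX j)) ⟨
        (X ⊗ (L ⊗ X)) i ∙ 1s                            ≈⟨ ⊗-∙ X (L ⊗ X) 1s i ⟩
        X i ∙ (λ k → (L ⊗ X) k ∙ 1s)
          ≈⟨ sum-zero (λ k → trans (*-congˡ (LX1≈0 k)) (zeroʳ (X i k))) ⟩
        0#                                              ∎
        where
        1s : Vector Carrier n
        1s _ = 1#
        sym-XLX : ∀ j → (X ⊗ (L ⊗ X)) i j ≈ X i j
        sym-XLX j = trans (sym (⊗-assoc X L X i j)) (A†AA†≋A† mp i j)
        LX1≈0 : ∀ k → (L ⊗ X) k ∙ 1s ≈ 0#
        LX1≈0 k = begin
          (L ⊗ X) k ∙ 1s
            ≈⟨ sum-cong-≋ (λ j → *-congʳ (trans (sym (AA†-selfAdj mp k j)) (⊗-ᵀ L X k j))) ⟩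
          (X ᵀ ⊗ L ᵀ) k ∙ 1s                 ≈⟨ ⊗-∙ (X ᵀ) (L ᵀ) 1s k ⟩
          (X ᵀ) k ∙ (λ l → (L ᵀ) l ∙ 1s)     ≈⟨ sum-zero (λ l → trans (*-congˡ (Lᵀ1≈0 l)) (zeroʳ (X l k))) ⟩
          0#                                 ∎
          where
          Lᵀ1≈0 : ∀ l → (L ᵀ) l ∙ 1s ≈ 0#
          Lᵀ1≈0 l = trans (sum-cong-≋ λ j → trans (*-identityʳ _) (laplacian-sym j l)) (laplacian-rowSum l)

      -- X = XLX is symmetric, so its form at v is the form of L at Xv.
      pinv-nonneg : ∀ v → 0# ≤ form X v
      pinv-nonneg v = ≤-resp refl (sym form≈) (laplacian-nonneg w)
        where
        w : Vector Carrier n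
        w i = X i ∙ v
        form≈ : form X v ≈ form L w
        form≈ = begin
          v ∙ w
            ≈⟨ sum-cong-≋ (λ i → *-congˡ {v i} (sum-cong-≋ λ j → *-congʳ {v j} (sym (XLX i j)))) ⟩
          v ∙ (λ i → (X ⊗ (L ⊗ X)) i ∙ v)
            ≈⟨ sum-cong-≋ (λ i → *-congˡ {v i}
                (trans (⊗-∙ X (L ⊗ X) v i) (sum-cong-≋ λ k → *-congˡ {X i k} (⊗-∙ L X v k)))) ⟩
          v ∙ (λ i → X i ∙ z)
            ≈⟨ sum-cong-≋ (λ i → *-distribˡ-sum (v i) λ k → X i k * z k) ⟩
          sum (λ i → sum λ k → v i * (X i k * z k))       ≈⟨ ∑-comm (λ i k → v i * (X i k * z k)) ⟩
          sum (λ k → sum λ i → v i * (X i k * z k))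
            ≈⟨ sum-cong-≋ (λ k → trans
                (sum-cong-≋ λ i → trans (*-congˡ {v i} (*-congʳ {z k} (pinv-sym i k)))
                  (solve 3 (λ v x z → v :* (x :* z) := x :* v :* z) refl (v i) (X k i) (z k)))
                (sym (*-distribʳ-sum (z k) λ i → X k i * v i))) ⟩
          w ∙ z                                           ∎
          where
          z : Vector Carrier n
          z k = L k ∙ w
          XLX : ∀ i j → (X ⊗ (L ⊗ X)) i j ≈ X i j
          XLX i j = trans (sym (⊗-assoc X L X i j)) (A†AA†≋A† mp i j)

      module _ {R : Matrix n n} (R≈ : ∀ i j → R i j ≈ X i i + X j j - fromℕ 2 * X i j)
               {κ : Carrier} (sum-R≈κ : ∀ i → sum (R i) ≈ κ) where

        resistance-rowSum : ∀ i → fromℕ n * X i i + sum (λ j → X j j) ≈ κ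
        resistance-rowSum i = trans (sym (begin
          sum (R i)
            ≈⟨ sum-linear (X i i) 1# {R i} {λ _ → 1#} {λ j → X j j - fromℕ 2 * X i j} (λ j → trans (R≈ i j)
                 (solve 3 (λ d e x → d :+ e :- con (+ 2) :* x :=
                     d :* con (+ 1) :+ con (+ 1) :* (e :- con (+ 2) :* x)) refl (X i i) (X j j) (X i j))) ⟩
          X i i * sum {n} (λ _ → 1#) + 1# * sum (λ j → X j j - fromℕ 2 * X i j)
            ≈⟨ +-cong (trans (*-congˡ (sum-replicate n)) (*-comm _ _)) (trans (*-identityˡ _)
                 (sum-linear 1# (- fromℕ 2) {h = X i} λ j → solve 2 (λ e x → e :- con (+ 2) :* x :=
                     con (+ 1) :* e :+ (:- con (+ 2)) :* x) refl (X j j) (X i j))) ⟩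
          fromℕ n * X i i + (1# * sum (λ j → X j j) + - fromℕ 2 * sum (X i))
            ≈⟨ +-congˡ (+-congˡ (*-congˡ (pinv-rowSum i))) ⟩
          fromℕ n * X i i + (1# * sum (λ j → X j j) + - fromℕ 2 * 0#)
            ≈⟨ solve 2 (λ a t → a :+ (con (+ 1) :* t :+ (:- con (+ 2)) :* con (+ 0)) := a :+ t)
                refl (fromℕ n * X i i) (sum λ j → X j j) ⟩
          fromℕ n * X i i + sum (λ j → X j j) ∎)) (sum-R≈κ i)

        -- The i-th row sum of R is  n Xᵢᵢ + tr X,  as the rows of X sum to zero.
        pinv-diagonal-const : ∀ i j → X i i ≈ X j j
        pinv-diagonal-const i j = *-cancelˡ (fromℕ#0 i) (begin
          fromℕ n * X i i                ≈⟨ solve 2 (λ a t → a := a :+ t :- t) refl _ t ⟩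
          fromℕ n * X i i + t - t        ≈⟨ +-congʳ (trans (resistance-rowSum i) (sym (resistance-rowSum j))) ⟩
          fromℕ n * X j j + t - t        ≈⟨ solve 2 (λ a t → a :+ t :- t := a) refl _ t ⟩
          fromℕ n * X j j                ∎)
          where
          t = sum λ j → X j j

        resistance-rowSum≈ : ∀ i → κ ≈ fromℕ n * (X i i + X i i)
        resistance-rowSum≈ i = begin
          κ                                     ≈⟨ resistance-rowSum i ⟨
          fromℕ n * X i i + sum (λ j → X j j)
            ≈⟨ +-congˡ (trans (sum-cong-≋ λ j → trans (pinv-diagonal-const j i) (sym (*-identityʳ _)))
                (trans (sym (*-distribˡ-sum {n} (X i i) λ _ → 1#)) (*-congˡ (sum-replicate n)))) ⟩
          fromℕ n * X i i + X i i * fromℕ n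
            ≈⟨ solve 2 (λ m x → m :* x :+ x :* m := m :* (x :+ x)) refl (fromℕ n) (X i i) ⟩
          fromℕ n * (X i i + X i i)             ∎

        0≤rowSum : Fin n → 0# ≤ κ
        0≤rowSum i = ≤-resp refl (sym (resistance-rowSum≈ i)) (0≤* 0≤fromℕ (0≤+ 0≤Xᵢᵢ 0≤Xᵢᵢ))
          where
          0≤fromℕ : 0# ≤ fromℕ n
          0≤fromℕ = ≤-resp refl (sum-replicate n) (sum-nonneg {n} (λ _ → 1#) λ _ → <⇒≤ 0<1#)
          0≤Xᵢᵢ : 0# ≤ X i i
          0≤Xᵢᵢ = ≤-resp refl (begin
            identity i ∙ (λ j → X j ∙ identity i)   ≈⟨ identity-∙ i (λ j → X j ∙ identity i) ⟩
            X i ∙ identity i                        ≈⟨ sum-cong-≋ (λ j → *-comm (X i j) (identity i j)) ⟩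
            identity i ∙ X i                        ≈⟨ identity-∙ i (X i) ⟩
            X i i                                   ∎) (pinv-nonneg (identity i))

        -- With d the diagonal entry of X, R = 2dJ - 2X has the all-ones eigenvector for
        -- κ.  If ρ > κ had an eigenvector v, its entries would sum to 0, so that
        -- ρ |v|² = -2 vᵀXv ≤ 0  although ρ > 0.
        largestEigenvalue≈rowSum : Fin n → ∀ {ρ} → IsLargestEigenvalue R ρ → ρ ≈ κ
        largestEigenvalue≈rowSum i₀ {ρ} ((v , v≉0 , Rv≈ρv) , ρ-largest) = ≤-antisym ρ≤κ κ≤ρ
          where
          κ≤ρ : κ ≤ ρ
          κ≤ρ = ρ-largest κ ((λ _ → 1#) , (λ 1≈0 → <⇒≉ 0<1# (sym (1≈0 i₀))) , λ i →
            trans (sum-cong-≋ λ j → *-identityʳ (R i j)) (trans (sum-R≈κ i) (sym (*-identityʳ κ))))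
          δ = X i₀ i₀
          σ = sum v
          Rᵢ∙v : ∀ i → ρ * v i ≈ (δ + δ) * σ + - fromℕ 2 * (X i ∙ v)
          Rᵢ∙v i = trans (sym (Rv≈ρv i)) (sum-linear (δ + δ) (- fromℕ 2) λ j → trans
            (*-congʳ (trans (R≈ i j) (+-congʳ (+-cong (pinv-diagonal-const i i₀) (pinv-diagonal-const j i₀)))))
            (solve 3 (λ d x v → (d :+ d :- con (+ 2) :* x) :* v := (d :+ d) :* v :+ (:- con (+ 2)) :* (x :* v))
                refl δ (X i j) (v j)))
          ρσ≈κσ : ρ * σ ≈ κ * σ
          ρσ≈κσ = begin
            ρ * sum v                                                       ≈⟨ *-distribˡ-sum ρ v ⟩
            sum (λ i → ρ * v i)
              ≈⟨ sum-linear ((δ + δ) * σ) (- fromℕ 2) {g = λ _ → 1#} {λ i → X i ∙ v}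
                  (λ i → trans (Rᵢ∙v i) (+-congʳ (sym (*-identityʳ _)))) ⟩
            (δ + δ) * σ * sum {n} (λ _ → 1#) + - fromℕ 2 * sum (λ i → X i ∙ v)
              ≈⟨ +-cong (*-congˡ (sum-replicate n)) (*-congˡ ΣXv≈0) ⟩
            (δ + δ) * σ * fromℕ n + - fromℕ 2 * 0#
              ≈⟨ solve 3 (λ d s m → (d :+ d) :* s :* m :+ (:- con (+ 2)) :* con (+ 0) := m :* (d :+ d) :* s)
                  refl δ σ (fromℕ n) ⟩
            fromℕ n * (δ + δ) * σ                                           ≈⟨ *-congʳ (resistance-rowSum≈ i₀) ⟨
            κ * σ                                                           ∎
            where
            ΣXv≈0 : sum (λ i → X i ∙ v) ≈ 0#
            ΣXv≈0 = trans (∑-comm λ i j → X i j * v j)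
                (sum-zero λ j → trans (sym (*-distribʳ-sum (v j) λ i → X i j))
              (trans (*-congʳ (trans (sum-cong-≋ λ i → pinv-sym i j) (pinv-rowSum j))) (zeroˡ (v j))))
          ρ≤κ : ρ ≤ κ
          ρ≤κ κ<ρ = v≉0 λ i → sq≈0⇒≈0 (sum-nonneg-≈0 (λ i → v i * v i) (λ i → 0≤sq (v i)) (≤-reflexive v∙v≈0) i)
            where
            0<ρ : 0# < ρ
            0<ρ = ≤-<-trans (0≤rowSum i₀) κ<ρ
            σ≈0 : σ ≈ 0#
            σ≈0 = *-cancelˡ-0 (inj₂ (x<y⇒0<y-x κ<ρ)) (begin
              (ρ - κ) * σ          ≈⟨ solve 3 (λ r k s → (r :- k) :* s := r :* s :- k :* s) refl ρ κ σ ⟩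
              ρ * σ - κ * σ        ≈⟨ +-congʳ ρσ≈κσ ⟩
              κ * σ - κ * σ        ≈⟨ -‿inverseʳ _ ⟩
              0#                   ∎)
            ρv∙v≈ : - (ρ * (v ∙ v)) ≈ form X v + form X v
            ρv∙v≈ = begin
              - (ρ * (v ∙ v))
                ≈⟨ -‿cong (*-distribˡ-sum ρ λ i → v i * v i) ⟩
              - sum (λ i → ρ * (v i * v i))
                ≈⟨ -‿cong (sum-linear 0# (- fromℕ 2) {g = v} {λ i → v i * (X i ∙ v)} λ i → trans
                     (solve 2 (λ r v → r :* (v :* v) := v :* (r :* v)) refl ρ (v i))
                         (trans (*-congˡ (trans (Rᵢ∙v i) (+-congʳ (trans (*-congˡ σ≈0) (zeroʳ _)))))
                     (solve 2 (λ v x → v :* (con (+ 0) :+ (:- con (+ 2)) :* x) :=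
                         con (+ 0) :* v :+ (:- con (+ 2)) :* (v :* x)) refl (v i) (X i ∙ v)))) ⟩
              - (0# * σ + - fromℕ 2 * form X v)
                ≈⟨ solve 2 (λ s q → :- (con (+ 0) :* s :+ (:- con (+ 2)) :* q) := q :+ q) refl σ (form X v) ⟩
              form X v + form X v                                   ∎
            v∙v≈0 : v ∙ v ≈ 0#
            v∙v≈0 = *-cancelˡ-0 (inj₂ 0<ρ) (≤-antisym
              (0≤y-x⇒x≤y (≤-resp refl (sym (trans (+-identityˡ _) ρv∙v≈))
                  (0≤+ (pinv-nonneg v) (pinv-nonneg v))))
              (0≤* (<⇒≤ 0<ρ) (∙-nonneg v)))

-- The double graph
module Double {c ℓ₁ ℓ₂} (ℝ : RealField c ℓ₁ ℓ₂) where

  open RealAlgebra ℝ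
  open Order ℝ
  open Determinant ℝ
  open QuadraticForm ℝ
  open Spectrum ℝ
  open PseudoInverse ℝ
  open IsMoorePenroseInverse
  open Graph

  private variable
    m n : ℕ

  sum-splitAt : ∀ m {n} (f : Fin m ⊎ Fin n → Carrier) →
                sum (λ u → f (splitAt m u)) ≈ sum (λ i → f (inj₁ i)) + sum (λ j → f (inj₂ j))
  sum-splitAt zero    f = sym (+-identityˡ _)
  sum-splitAt (suc m) f = trans (+-congˡ (sum-splitAt m λ x → f (Sum.map₁ suc x))) (sym (+-assoc _ _ _))

  -- The inverse of 2.
  ½ : Carrier
  ½ = proj₁ (inverse (inj₂ (0<fromℕ 1)))

  2*½≈1 : fromℕ 2 * ½ ≈ 1#
  2*½≈1 = proj₂ (inverse (inj₂ (0<fromℕ 1)))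

  ½+½≈1 : ½ + ½ ≈ 1#
  ½+½≈1 = trans (solve 1 (λ h → h :+ h := con (+ 2) :* h) refl ½) 2*½≈1

  -- The entries of P ⊕ Q, indexed by vertices vᵢ and copies vᵢ′.
  block : Matrix n n → Matrix n n → Fin n ⊎ Fin n → Fin n ⊎ Fin n → Carrier
  block P Q (inj₁ i) (inj₁ j) = ½ * (P i j + Q i j)
  block P Q (inj₁ i) (inj₂ j) = ½ * (P i j - Q i j)
  block P Q (inj₂ i) (inj₁ j) = ½ * (P i j - Q i j)
  block P Q (inj₂ i) (inj₂ j) = ½ * (P i j + Q i j)

  -- The matrix of order 2n acting as P on the vectors (v, v) and as Q on the
  -- vectors (v, -v).  It depends on P and Q as a direct sum does.
  infixl 6 _⊕_
  _⊕_ : Matrix n n → Matrix n n → Matrix (n ℕ.+ n) (n ℕ.+ n)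
  _⊕_ {n} P Q u w = block P Q (splitAt n u) (splitAt n w)

  ⊕-cong : {P P′ Q Q′ : Matrix n n} → P ≋ P′ → Q ≋ Q′ → P ⊕ Q ≋ P′ ⊕ Q′
  ⊕-cong {n} {P} {P′} {Q} {Q′} P≋P′ Q≋Q′ u w = lemma (splitAt n u) (splitAt n w)
    where
    lemma : ∀ x y → block P Q x y ≈ block P′ Q′ x y
    lemma (inj₁ i) (inj₁ j) = *-congˡ (+-cong (P≋P′ i j) (Q≋Q′ i j))
    lemma (inj₁ i) (inj₂ j) = *-congˡ (+-cong (P≋P′ i j) (-‿cong (Q≋Q′ i j)))
    lemma (inj₂ i) (inj₁ j) = *-congˡ (+-cong (P≋P′ i j) (-‿cong (Q≋Q′ i j)))
    lemma (inj₂ i) (inj₂ j) = *-congˡ (+-cong (P≋P′ i j) (Q≋Q′ i j))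

  ⊕-ᵀ : (P Q : Matrix n n) → (P ⊕ Q) ᵀ ≋ (P ᵀ) ⊕ (Q ᵀ)
  ⊕-ᵀ {n} P Q u w = lemma (splitAt n u) (splitAt n w)
    where
    lemma : ∀ x y → block P Q y x ≈ block (P ᵀ) (Q ᵀ) x y
    lemma (inj₁ i) (inj₁ j) = refl
    lemma (inj₁ i) (inj₂ j) = refl
    lemma (inj₂ i) (inj₁ j) = refl
    lemma (inj₂ i) (inj₂ j) = refl

  ⊕-⊗ : (P Q P′ Q′ : Matrix n n) → (P ⊕ Q) ⊗ (P′ ⊕ Q′) ≋ (P ⊗ P′) ⊕ (Q ⊗ Q′)
  ⊕-⊗ {n} P Q P′ Q′ u w = trans
    (sum-splitAt n λ t → block P Q (splitAt n u) t * block P′ Q′ t (splitAt n w))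
    (lemma (splitAt n u) (splitAt n w))
    where
    same : ∀ p q p′ q′ → ½ * (p + q) * (½ * (p′ + q′)) + ½ * (p - q) * (½ * (p′ - q′)) ≈ ½ * (p * p′)
        + ½ * (q * q′)
    same p q p′ q′ = trans
      (solve 5 (λ h p q p′ q′ → h :* (p :+ q) :* (h :* (p′ :+ q′)) :+ h :* (p :- q) :* (h :* (p′ :- q′)) :=
                                 (h :+ h) :* (h :* (p :* p′) :+ h :* (q :* q′))) refl ½ p q p′ q′)
      (trans (*-congʳ ½+½≈1) (*-identityˡ _))
    cross : ∀ p q p′ q′ → ½ * (p + q) * (½ * (p′ - q′)) + ½ * (p - q) * (½ * (p′ + q′)) ≈ ½ * (p * p′)
        + - ½ * (q * q′)
    cross p q p′ q′ = trans
      (solve 5 (λ h p q p′ q′ → h :* (p :+ q) :* (h :* (p′ :- q′)) :+ h :* (p :- q) :* (h :* (p′ :+ q′)) :=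
                                 (h :+ h) :* (h :* (p :* p′) :+ (:- h) :* (q :* q′))) refl ½ p q p′ q′)
      (trans (*-congʳ ½+½≈1) (*-identityˡ _))
    sum-same : ∀ i j → sum (λ k → ½ * (P i k + Q i k) * (½ * (P′ k j + Q′ k j)))
        + sum (λ k → ½ * (P i k - Q i k) * (½ * (P′ k j - Q′ k j)))
                       ≈ ½ * ((P ⊗ P′) i j + (Q ⊗ Q′) i j)
    sum-same i j = trans (sym (∑-distrib-+ (λ k → ½ * (P i k + Q i k) * (½ * (P′ k j + Q′ k j))) λ k →
        ½ * (P i k - Q i k) * (½ * (P′ k j - Q′ k j))))
      (trans (sum-linear ½ ½ λ k → same (P i k) (Q i k) (P′ k j) (Q′ k j)) (sym (distribˡ ½ _ _)))
    sum-cross : ∀ i j → sum (λ k → ½ * (P i k + Q i k) * (½ * (P′ k j - Q′ k j)))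
        + sum (λ k → ½ * (P i k - Q i k) * (½ * (P′ k j + Q′ k j)))
                        ≈ ½ * ((P ⊗ P′) i j - (Q ⊗ Q′) i j)
    sum-cross i j = trans (sym (∑-distrib-+ (λ k → ½ * (P i k + Q i k) * (½ * (P′ k j - Q′ k j))) λ k →
        ½ * (P i k - Q i k) * (½ * (P′ k j + Q′ k j))))
      (trans (sum-linear ½ (- ½) λ k → cross (P i k) (Q i k) (P′ k j) (Q′ k j))
        (solve 3 (λ h a b → h :* a :+ (:- h) :* b := h :* (a :- b)) refl ½ ((P ⊗ P′) i j) ((Q ⊗ Q′) i j)))
    lemma : ∀ x y → sum (λ k → block P Q x (inj₁ k) * block P′ Q′ (inj₁ k) y)
        + sum (λ k → block P Q x (inj₂ k) * block P′ Q′ (inj₂ k) y)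
                    ≈ block (P ⊗ P′) (Q ⊗ Q′) x y
    lemma (inj₁ i) (inj₁ j) = sum-same i j
    lemma (inj₁ i) (inj₂ j) = sum-cross i j
    lemma (inj₂ i) (inj₁ j) = trans (+-comm _ _) (sum-cross i j)
    lemma (inj₂ i) (inj₂ j) = trans (+-comm _ _) (sum-same i j)

  MP-⊕ : {P Q P† Q† : Matrix n n} → IsMoorePenroseInverse P P† → IsMoorePenroseInverse Q Q† →
         IsMoorePenroseInverse (P ⊕ Q) (P† ⊕ Q†)
  MP-⊕ {P = P} {Q} {P†} {Q†} mpP mpQ = record
    { AA†A≋A = λ i j → trans (triple P Q P† Q† P Q i j) (⊕-cong (AA†A≋A mpP) (AA†A≋A mpQ) i j)
    ; A†AA†≋A† = λ i j → trans (triple P† Q† P Q P† Q† i j) (⊕-cong (A†AA†≋A† mpP) (A†AA†≋A† mpQ) i j)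
    ; AA†-selfAdj = λ i j → begin
        ((P ⊕ Q) ⊗ (P† ⊕ Q†)) j i           ≈⟨ ⊕-⊗ P Q P† Q† j i ⟩
        ((P ⊗ P†) ⊕ (Q ⊗ Q†)) j i           ≈⟨ ⊕-ᵀ (P ⊗ P†) (Q ⊗ Q†) i j ⟩
        ((P ⊗ P†) ᵀ ⊕ (Q ⊗ Q†) ᵀ) i j       ≈⟨ ⊕-cong (AA†-selfAdj mpP) (AA†-selfAdj mpQ) i j ⟩
        ((P ⊗ P†) ⊕ (Q ⊗ Q†)) i j           ≈⟨ ⊕-⊗ P Q P† Q† i j ⟨
        ((P ⊕ Q) ⊗ (P† ⊕ Q†)) i j           ∎
    ; A†A-selfAdj = λ i j → begin
        ((P† ⊕ Q†) ⊗ (P ⊕ Q)) j i           ≈⟨ ⊕-⊗ P† Q† P Q j i ⟩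
        ((P† ⊗ P) ⊕ (Q† ⊗ Q)) j i           ≈⟨ ⊕-ᵀ (P† ⊗ P) (Q† ⊗ Q) i j ⟩
        ((P† ⊗ P) ᵀ ⊕ (Q† ⊗ Q) ᵀ) i j       ≈⟨ ⊕-cong (A†A-selfAdj mpP) (A†A-selfAdj mpQ) i j ⟩
        ((P† ⊗ P) ⊕ (Q† ⊗ Q)) i j           ≈⟨ ⊕-⊗ P† Q† P Q i j ⟨
        ((P† ⊕ Q†) ⊗ (P ⊕ Q)) i j           ∎
    }
    where
    triple : ∀ A B A′ B′ A″ B″ → (A ⊕ B) ⊗ (A′ ⊕ B′) ⊗ (A″ ⊕ B″) ≋ (A ⊗ A′ ⊗ A″) ⊕ (B ⊗ B′ ⊗ B″)
    triple A B A′ B′ A″ B″ i j = trans (⊗-congʳ (A″ ⊕ B″) (⊕-⊗ A B A′ B′) i j) (⊕-⊗ (A ⊗ A′) (B ⊗ B′) A″ B″ i j)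

  -- The identity matrix on a disjoint union.
  δ : Fin m ⊎ Fin n → Fin m ⊎ Fin n → Carrier
  δ (inj₁ i) (inj₁ j) = identity i j
  δ (inj₁ i) (inj₂ j) = 0#
  δ (inj₂ i) (inj₁ j) = 0#
  δ (inj₂ i) (inj₂ j) = identity i j

  identity-splitAt : ∀ m {n} (u w : Fin (m ℕ.+ n)) → identity u w ≈ δ (splitAt m u) (splitAt m w)
  identity-splitAt zero    u w = refl
  identity-splitAt (suc m) zero zero = refl
  identity-splitAt (suc m) zero (suc w) with splitAt m w
  ... | inj₁ j = refl
  ... | inj₂ j = refl
  identity-splitAt (suc m) (suc u) zero with splitAt m u
  ... | inj₁ i = refl
  ... | inj₂ i = refl
  identity-splitAt (suc m) (suc u) (suc w) = trans (identity-splitAt m u w) (shift (splitAt m u) (splitAt m w))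
    where
    shift : ∀ {m n} (x y : Fin m ⊎ Fin n) → δ x y ≈ δ (Sum.map₁ suc x) (Sum.map₁ suc y)
    shift (inj₁ i) (inj₁ j) = refl
    shift (inj₁ i) (inj₂ j) = refl
    shift (inj₂ i) (inj₁ j) = refl
    shift (inj₂ i) (inj₂ j) = refl

  -- The vertex of which x is a copy.
  original : Fin n ⊎ Fin n → Fin n
  original (inj₁ i) = i
  original (inj₂ i) = i

  adjacency-double : (G : Graph n) → ∀ u w →
    adjacencyMatrix (double G) u w ≈ adjacencyMatrix G (original (splitAt n u)) (original (splitAt n w))
  adjacency-double {n} G u w with splitAt n u | splitAt n w
  ... | inj₁ i | inj₁ j = refl
  ... | inj₁ i | inj₂ j = adjacency-sym G j i
  ... | inj₂ i | inj₁ j = refl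
  ... | inj₂ i | inj₂ j = refl

  degree-double : (G : Graph n) → ∀ u → let d = fromℕ (degree G (original (splitAt n u))) in
                  fromℕ (degree (double G) u) ≈ d + d
  degree-double {n} G u = begin
    fromℕ (degree (double G) u)                               ≈⟨ fromℕ-degree (double G) u ⟩
    sum (adjacencyMatrix (double G) u)                        ≈⟨ sum-cong-≋ (adjacency-double G u) ⟩
    sum (λ w → adjacencyMatrix G i (original (splitAt n w)))
      ≈⟨ sum-splitAt n (λ y → adjacencyMatrix G i (original y)) ⟩
    sum (adjacencyMatrix G i) + sum (adjacencyMatrix G i)     ≈⟨ +-cong (fromℕ-degree G i) (fromℕ-degree G i) ⟨
    fromℕ (degree G i) + fromℕ (degree G i)                   ∎
    where
    i = original (splitAt n u)

  module _ (G : Graph n) (r : ℕ) (regular : Regular G r) where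
    private
      ϱ : Carrier
      ϱ = fromℕ r
      2L 2rI : Matrix n n
      2L i j = fromℕ 2 * laplacian G i j
      2rI i j = (ϱ + ϱ) * identity i j

    -- On the vectors (v, v) the adjacency matrix of the double graph is twice that
    -- of G, on the vectors (v, -v) it vanishes, and all degrees are 2r.
    laplacian-double : laplacian (double G) ≋ 2L ⊕ 2rI
    laplacian-double u w = begin
      fromℕ (degree (double G) u) * identity u w - adjacencyMatrix (double G) u w
        ≈⟨ +-cong (*-cong (trans (degree-double G u) (+-cong (d≈ϱ _) (d≈ϱ _))) (identity-splitAt n u w))
            (-‿cong (adjacency-double G u w)) ⟩
      (ϱ + ϱ) * δ (splitAt n u) (splitAt n w) - adjacencyMatrix G (original (splitAt n u))
          (original (splitAt n w))
        ≈⟨ lemma (splitAt n u) (splitAt n w) ⟩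
      block 2L 2rI (splitAt n u) (splitAt n w) ∎
      where
      A = adjacencyMatrix G
      d≈ϱ : ∀ i → fromℕ (degree G i) ≈ ϱ
      d≈ϱ i = reflexive (≡.cong fromℕ (regular i))
      same : ∀ i j → (ϱ + ϱ) * identity i j - A i j ≈ ½ * (2L i j + 2rI i j)
      same i j = sym (trans (*-congˡ (+-congʳ (*-congˡ (+-congʳ (*-congʳ (d≈ϱ i))))))
        (trans (solve 4 (λ h d e a → h :* (con (+ 2) :* (d :* e :- a) :+ (d :+ d) :* e) :=
            con (+ 2) :* h :* ((d :+ d) :* e :- a)) refl ½ ϱ (identity i j) (A i j))
          (trans (*-congʳ 2*½≈1) (*-identityˡ _))))
      cross : ∀ i j → (ϱ + ϱ) * 0# - A i j ≈ ½ * (2L i j - 2rI i j)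
      cross i j = sym (trans (*-congˡ (+-congʳ (*-congˡ (+-congʳ (*-congʳ (d≈ϱ i))))))
        (trans (solve 4 (λ h d e a → h :* (con (+ 2) :* (d :* e :- a) :- (d :+ d) :* e) :=
            con (+ 2) :* h :* ((d :+ d) :* con (+ 0) :- a)) refl ½ ϱ (identity i j) (A i j))
          (trans (*-congʳ 2*½≈1) (*-identityˡ _))))
      lemma : ∀ x y → (ϱ + ϱ) * δ x y - A (original x) (original y) ≈ block 2L 2rI x y
      lemma (inj₁ i) (inj₁ j) = same i j
      lemma (inj₁ i) (inj₂ j) = cross i j
      lemma (inj₂ i) (inj₁ j) = cross i j
      lemma (inj₂ i) (inj₂ j) = same i j

    -- The Moore-Penrose inverse of  2L ⊕ 2rI  is  ½X ⊕ sI  with s = 1 / (2r).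
    pinv-double-diagonal : ∀ {X Y s} → IsMoorePenroseInverse (laplacian G) X →
      IsMoorePenroseInverse (laplacian (double G)) Y → (ϱ + ϱ) * s ≈ 1# →
      ∀ u → Y u u ≈ ½ * (½ * X (original (splitAt n u)) (original (splitAt n u)) + s)
    pinv-double-diagonal {X} {Y} {s} mpX mpY 2rs≈1 u = trans
      (MP-unique mpY (MP-cong (λ u w → sym (laplacian-double u w))
          (MP-⊕ (MP-scale 2*½≈1 mpX) (MP-scale 2rs≈1 MP-identity))) u u)
      (lemma (splitAt n u))
      where
      identity-diagonal : ∀ {n} (i : Fin n) → identity i i ≈ 1#
      identity-diagonal zero    = refl
      identity-diagonal (suc i) = identity-diagonal i
      lemma : ∀ x → block (λ i j → ½ * X i j) (λ i j → s * identity i j) x x ≈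
          ½ * (½ * X (original x) (original x) + s)
      lemma (inj₁ i) = *-congˡ (+-congˡ (trans (*-congˡ (identity-diagonal i)) (*-identityʳ s)))
      lemma (inj₂ i) = *-congˡ (+-congˡ (trans (*-congˡ (identity-diagonal i)) (*-identityʳ s)))

  -- A walk between two distinct vertices starts with an edge.
  connected⇒positiveDegree : (G : Graph (suc (suc n))) → Connected G → ∀ r → Regular G r → 0 ℕ.< r
  connected⇒positiveDegree G connected (suc r) regular = ℕ.s≤s ℕ.z≤n
  connected⇒positiveDegree {n} G connected zero regular with connected zero (suc zero)
  ... | _◅_ {j = j} 0~j _ = contradiction
    (sum-nonneg-≈0 (adjacencyMatrix G zero) (adjacency-nonneg G zero)
      (≤-reflexive (trans (sym (fromℕ-degree G zero)) (reflexive (≡.cong fromℕ (regular zero))))) j)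
    λ a≈0 → <⇒≉ 0<1# (sym (trans (sym (adjacent⇒1 (adj G zero j) 0~j)) a≈0))
    where
    adjacent⇒1 : ∀ b → T b → (if b then 1# else 0#) ≈ 1#
    adjacent⇒1 true _ = refl

  -- With d on the diagonal of X, and N the order of G, the diagonal entry of Y is
  -- ½ (½ d + s), which gives R(D₂G) the row sum N d + 2 s N; the energy is twice
  -- that, and ρ₁ = 2 N d.
  resistanceEnergy-double : (G : Graph (suc (suc n))) → Connected G → (r : ℕ) → Regular G r →
    (k : Carrier) → ResistanceRegular G k → (ρ₁ : Carrier) → IsLargestResistanceEigenvalue G ρ₁ →
    (E : Carrier) → IsResistanceEnergy (double G) E → E ≈ ρ₁ + fromℕ (2 ℕ.* suc (suc n)) /ℕ r
  resistanceEnergy-double {n} G connected r regular k (R , (X , mpX , R≈) , sum-R≈k)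
    ρ₁ (R′ , (X′ , mpX′ , R′≈) , largest) E (S , (Y , mpY , S≈) , λs , spectrum , E≈) = begin
      E                                    ≈⟨ E≈ ⟩
      sum (λ i → abs (λs i))
        ≈⟨ energy Y S d₂ (pinv-sym G₂ mpY) (pinv-nonneg G₂ mpY) (pinv-rowSum G₂ mpY) Y-diagonal S≈′ λs
            spectrum ⟩
      (d₂ + d₂) * fromℕ (N ℕ.+ N) + (d₂ + d₂) * fromℕ (N ℕ.+ N)
        ≈⟨ +-cong (*-congˡ N+N≈) (*-congˡ N+N≈) ⟩
      (d₂ + d₂) * (M + M) + (d₂ + d₂) * (M + M)
        ≈⟨ solve 4 (λ h d s m → let e = h :* (h :* d :+ s) in (e :+ e) :* (m :+ m) :+ (e :+ e) :* (m :+ m) :=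
             con (+ 2) :* h :* (con (+ 2) :* h :* (m :* (d :+ d))) :+ con (+ 2) :* h :* (con (+ 4) :* s :* m))
                 refl ½ d s M ⟩
      fromℕ 2 * ½ * (fromℕ 2 * ½ * (M * (d + d))) + fromℕ 2 * ½ * (fromℕ 4 * s * M)
        ≈⟨ +-cong (trans (cancel _) (cancel _)) (cancel _) ⟩
      M * (d + d) + fromℕ 4 * s * M
        ≈⟨ +-cong (sym ρ₁≈) (*-cancelˡ (inj₂ 0<ϱ) (trans 4sM≈ (sym (/ℕ-inverse (fromℕ (2 ℕ.* N)) 0<r)))) ⟩
      ρ₁ + fromℕ (2 ℕ.* N) /ℕ r            ∎
    where
    N = suc (suc n)
    M = fromℕ N
    G₂ = double G
    d = X zero zero
    0<r : 0 ℕ.< r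
    0<r = connected⇒positiveDegree G connected r regular
    ϱ = fromℕ r
    0<ϱ : 0# < ϱ
    0<ϱ = positive 0<r
      where
      positive : ∀ {r} → 0 ℕ.< r → 0# < fromℕ r
      positive {suc r} _ = 0<fromℕ r
    0<ϱ+ϱ : 0# < ϱ + ϱ
    0<ϱ+ϱ = <-≤-trans 0<ϱ (0≤y-x⇒x≤y (≤-resp refl (solve 1 (λ r → r := r :+ r :- r) refl ϱ) (<⇒≤ 0<ϱ)))
    s = proj₁ (inverse (inj₂ 0<ϱ+ϱ))
    2rs≈1 : (ϱ + ϱ) * s ≈ 1#
    2rs≈1 = proj₂ (inverse (inj₂ 0<ϱ+ϱ))
    d₂ = ½ * (½ * d + s)
    cancel : ∀ x → fromℕ 2 * ½ * x ≈ x
    cancel x = trans (*-congʳ 2*½≈1) (*-identityˡ x)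
    Y-diagonal : ∀ u → Y u u ≈ d₂
    Y-diagonal u = trans (pinv-double-diagonal G r regular mpX mpY 2rs≈1 u)
      (*-congˡ (+-congʳ (*-congˡ (pinv-diagonal-const G mpX R≈ sum-R≈k _ zero))))
    S≈′ : ∀ u w → S u w ≈ d₂ + d₂ - (Y u w + Y u w)
    S≈′ u w = trans (S≈ u w) (trans (+-congʳ (+-cong (Y-diagonal u) (Y-diagonal w)))
      (solve 2 (λ e y → e :+ e :- con (+ 2) :* y := e :+ e :- (y :+ y)) refl d₂ (Y u w)))
    N+N≈ : fromℕ (N ℕ.+ N) ≈ M + M
    N+N≈ = ×-homo-+ 1# N N
    4sM≈ : ϱ * (fromℕ 4 * s * M) ≈ fromℕ (2 ℕ.* N)
    4sM≈ = begin
      ϱ * (fromℕ 4 * s * M)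
        ≈⟨ solve 3 (λ r s m → r :* (con (+ 4) :* s :* m) := (r :+ r) :* s :* (con (+ 2) :* m)) refl ϱ s M ⟩
      (ϱ + ϱ) * s * (fromℕ 2 * M)    ≈⟨ trans (*-congʳ 2rs≈1) (*-identityˡ _) ⟩
      fromℕ 2 * M                    ≈⟨ ×1-homo-* 2 N ⟨
      fromℕ (2 ℕ.* N)                ∎
    X′≋X : X′ ≋ X
    X′≋X = MP-unique mpX′ mpX
    R′≋R : R′ ≋ R
    R′≋R i j = trans (R′≈ i j) (trans (+-cong (+-cong (X′≋X i i) (X′≋X j j)) (-‿cong (*-congˡ (X′≋X i j))))
        (sym (R≈ i j)))
    ρ₁≈ : ρ₁ ≈ M * (d + d)
    ρ₁≈ = trans (largestEigenvalue≈rowSum G mpX′ R′≈ (λ i → trans (sum-cong-≋ (R′≋R i)) (sum-R≈k i)) zero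
        largest)
      (resistance-rowSum≈ G mpX R≈ sum-R≈k zero)

corollary5p1 : ∀ {c ℓ₁ ℓ₂} (ℝ : RealField c ℓ₁ ℓ₂) → let open Resistance ℝ in
    ∀ (n : ℕ) → 2 ≤ℕ n →
    (G : Graph n) → Connected G →
    (r : ℕ) → Regular G r →
    (k : Carrier) → ResistanceRegular G k →
    (ρ₁ : Carrier) → IsLargestResistanceEigenvalue G ρ₁ →
    (E : Carrier) → IsResistanceEnergy (double G) E →
    E ≈ ρ₁ + fromℕ (2 *ℕ n) /ℕ r
corollary5p1 ℝ (suc (suc n)) (s≤s (s≤s z≤n)) = Double.resistanceEnergy-double ℝ
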